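{- Fix an integer $r\ge 4$. Suppose $G$ is a graph with chromatic number $m$ and, for each integer $3\le \ell<r$, $$C_\ell(G)\le A_\ell\, m^{\ell-\varepsilon_\ell}$$ with $A_\ell\ge 1$ and $\varepsilon_\ell>0$. Then $$h_r(G)\ge c_{r,A}\,m^{\theta},\qquad \theta=\min\left\{1,\ \min_{3\le \ell<r}\frac{\varepsilon_\ell}{\ell-1}\right\},$$ where $c_{r,A}>0$ depends only on $r$ and the numbers $A_\ell$.
   Context: All graphs are finite and simple; subgraphs need not be induced. The girth of a forest is $\infty$. $h_r(G)=\max\{\chi(H): H\subseteq G,\ \operatorname{girth}(H)\ge r\}$, where $\chi$ is the chromatic number. $C_\ell(G)$ is the number of cycles of length $\ell$ in $G$, counted as unoriented simple subgraphs. -}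

module Defs where

open import Data.Empty using (⊥-elim; ⊥-elim-irr)
import Data.Nat.Properties as ℕₚ
open import Data.Product using (∃; ∃₂; _×_; _,_; proj₁; proj₂)
open import Data.Sum using (_⊎_; inj₁; inj₂; [_,_]′)
open import Relation.Binary.PropositionalEquality
open import Relation.Nullary using (¬_; Dec; yes; no; ¬?; _×-dec_; _⊎-dec_; _→-dec_)

module Graphs where

  open import Data.Bool using (Bool; true; false)
  open import Data.Fin as Fin using (Fin; toℕ)
  import Data.Fin.Properties as Finₚ
  open import Data.Fin.Subset using (Subset; _∈_; _⊆_; ⊥)
  open import Data.Fin.Subset.Properties using (_∈?_; _⊆?_; ∉⊥)
  open import Data.List as List using (List; []; _∷_; filter; length; upTo; allFin; cartesianProduct; cartesianProductWith)
  open import Data.List.Extrema.Nat using (max; min)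
  import Data.List.Extrema.Nat as Extrema
  import Data.List.Membership.Propositional as ListMem
  import Data.List.Membership.Propositional.Properties as ∈ₚ
  open import Data.List.Relation.Unary.All as All using (All)
  open import Data.List.Relation.Unary.Any as Any using (Any; here; there)
  open import Data.List.Relation.Unary.AllPairs using ([]; _∷_)
  open import Data.List.Relation.Unary.Unique.Propositional as Uniqueᴸ using ()
  import Data.List.Relation.Unary.Unique.Propositional.Properties as Uniqueₚ
  open import Data.Nat using (ℕ; zero; suc; _≤_; _<_; _≤?_; _<?_; _≟_; z≤n; s≤s)
  open import Data.Vec as Vec using (Vec; []; _∷_; lookup; tabulate)
  import Data.Vec.Properties as Vecₚ
  import Data.Vec.Membership.Propositional as VecMem
  import Data.Vec.Membership.DecPropositional as DecVec
  import Data.Vec.Relation.Unary.Any as Anyᵛ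
  import Data.Vec.Relation.Unary.AllPairs as AllPairsᵛ
  open import Data.Vec.Relation.Unary.Unique.Propositional using (Unique)
  open import Function using (_∘_; _⇔_; mk⇔; Equivalence)
  import Relation.Nullary.Decidable as Dec
  open import Relation.Unary using (Decidable)

  private variable n : ℕ

  Simple : Subset n → Vec (Subset n) n → Set
  Simple V N = (∀ u v → v ∈ lookup N u → u ∈ lookup N v)
             × (∀ v → ¬ v ∈ lookup N v)
             × (∀ u v → v ∈ lookup N u → u ∈ V)

  -- A finite simple graph whose vertices are some of the labels in Fin n, so that its subgraphs
  -- are again graphs over the same labels.  Row u of nbrs is the neighbourhood of u.  The last
  -- field is irrelevant so that graphs with the same vertices and edges are equal.
  record Graph (n : ℕ) : Set where
    constructor mkGraph
    field
      V       : Subset n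
      nbrs    : Vec (Subset n) n
      .simple : Simple V nbrs

  open Graph using (V; nbrs)

  infix 4 _⊑_ _⊑?_

  _~[_]_ : Fin n → Graph n → Fin n → Set
  u ~[ G ] v = v ∈ lookup (nbrs G) u

  _~?[_]_ : (u : Fin n) (G : Graph n) (v : Fin n) → Dec (u ~[ G ] v)
  u ~?[ G ] v = v ∈? lookup (nbrs G) u

  _⊑_ : Graph n → Graph n → Set
  H ⊑ G = V H ⊆ V G × (∀ u v → u ~[ H ] v → u ~[ G ] v)

  _⊑?_ : (H G : Graph n) → Dec (H ⊑ G)
  H ⊑? G = (V H ⊆? V G) ×-dec Finₚ.all? λ u → Finₚ.all? λ v → (u ~?[ H ] v) →-dec (u ~?[ G ] v)

  vectors : {A : Set} → List A → ∀ n → List (Vec A n)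
  vectors xs zero    = [] ∷ []
  vectors xs (suc n) = cartesianProductWith _∷_ xs (vectors xs n)

  module _ {A : Set} {xs : List A} where
    ∈-vectors : ∀ {n} (v : Vec A n) → (∀ i → lookup v i ListMem.∈ xs) → v ListMem.∈ vectors xs n
    ∈-vectors []      _   = here refl
    ∈-vectors (x ∷ v) all = ∈ₚ.∈-cartesianProductWith⁺ _∷_ (all Fin.zero) (∈-vectors v (all ∘ Fin.suc))

    vectors-! : Uniqueᴸ.Unique xs → ∀ n → Uniqueᴸ.Unique (vectors xs n)
    vectors-! xs! zero    = All.[] ∷ []
    vectors-! xs! (suc n) = Uniqueₚ.cartesianProductWith⁺ _∷_ Vecₚ.∷-injective xs! (vectors-! xs! n)

  searchVec : {A : Set} (xs : List A) {P : Vec A n → Set} → Decidable P →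
              (∀ v i → P v → lookup v i ListMem.∈ xs) → Dec (∃ P)
  searchVec {n} xs P? bounded = Dec.map′
    (λ w → let v , _ , Pv = ListMem.find w in v , Pv)
    (λ (v , Pv) → ListMem.lose (∈-vectors v (λ i → bounded v i Pv)) Pv)
    (Any.any? P? (vectors xs n))

  simple? : (V : Subset n) (N : Vec (Subset n) n) → Dec (Simple V N)
  simple? V N = (Finₚ.all? λ u → Finₚ.all? λ v → (v ∈? lookup N u) →-dec (u ∈? lookup N v))
          ×-dec (Finₚ.all? λ v → ¬? (v ∈? lookup N v))
          ×-dec (Finₚ.all? λ u → Finₚ.all? λ v → (v ∈? lookup N u) →-dec (u ∈? V))

  simple : (G : Graph n) → Simple (V G) (nbrs G)
  simple (mkGraph V N s) = Dec.recompute (simple? V N) s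

  bools : List Bool
  bools = true ∷ false ∷ []

  ∈-bools : ∀ b → b ListMem.∈ bools
  ∈-bools true  = here refl
  ∈-bools false = there (here refl)

  bools-! : Uniqueᴸ.Unique bools
  bools-! = ((λ ()) All.∷ All.[]) ∷ (All.[] ∷ [])

  graphsOn : List (Subset n × Vec (Subset n) n) → List (Graph n)
  graphsOn []             = []
  graphsOn ((V , N) ∷ xs) with simple? V N
  ... | yes s = mkGraph V N s ∷ graphsOn xs
  ... | no  _ = graphsOn xs

  graphs : ∀ n → List (Graph n)
  graphs n = graphsOn (cartesianProduct (vectors bools n) (vectors (vectors bools n) n))

  ∈-graphsOn⁺ : ∀ xs (G : Graph n) → (V G , nbrs G) ListMem.∈ xs → G ListMem.∈ graphsOn xs
  ∈-graphsOn⁺ ((V , N) ∷ xs) (mkGraph V N s) (here refl) with simple? V N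
  ... | yes _ = here refl
  ... | no ¬s = ⊥-elim-irr (¬s s)
  ∈-graphsOn⁺ ((V , N) ∷ xs) G (there p) with simple? V N
  ... | yes _ = there (∈-graphsOn⁺ xs G p)
  ... | no  _ = ∈-graphsOn⁺ xs G p

  ∈-graphsOn⁻ : ∀ xs (G : Graph n) → G ListMem.∈ graphsOn xs → (V G , nbrs G) ListMem.∈ xs
  ∈-graphsOn⁻ ((V , N) ∷ xs) G p with simple? V N
  ∈-graphsOn⁻ ((V , N) ∷ xs) G (here refl) | yes _ = here refl
  ∈-graphsOn⁻ ((V , N) ∷ xs) G (there p)   | yes _ = there (∈-graphsOn⁻ xs G p)
  ∈-graphsOn⁻ ((V , N) ∷ xs) G p           | no  _ = there (∈-graphsOn⁻ xs G p)

  ∈-graphs : (G : Graph n) → G ListMem.∈ graphs n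
  ∈-graphs G = ∈-graphsOn⁺ _ G (∈ₚ.∈-cartesianProduct⁺ (∈-subsets (V G))
    (∈-vectors (nbrs G) (λ u → ∈-subsets (lookup (nbrs G) u))))
    where
    ∈-subsets : (S : Subset n) → S ListMem.∈ vectors bools n
    ∈-subsets S = ∈-vectors S (λ u → ∈-bools (lookup S u))

  graphs-! : ∀ n → Uniqueᴸ.Unique (graphs n)
  graphs-! n = go (Uniqueₚ.cartesianProduct⁺ (vectors-! bools-! n) (vectors-! (vectors-! bools-! n) n))
    where
    go : ∀ {xs} → Uniqueᴸ.Unique xs → Uniqueᴸ.Unique (graphsOn {n} xs)
    go {[]}           _ = []
    go {(V , N) ∷ xs} (x∉xs ∷ xs!) with simple? V N
    ... | yes s = All.tabulate (λ { {G} G∈ refl → All.lookup x∉xs (∈-graphsOn⁻ xs G G∈) refl }) ∷ go xs!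
    ... | no  _ = go xs!

  Cyclic-suc : ∀ {ℓ} → Fin ℓ → Fin ℓ → Set
  Cyclic-suc {ℓ} i j = toℕ j ≡ suc (toℕ i) ⊎ (suc (toℕ i) ≡ ℓ × toℕ j ≡ 0)

  Consecutive : ∀ {ℓ} → Vec (Fin n) ℓ → Fin n → Fin n → Set
  Consecutive vs u w = ∃₂ λ i j → Cyclic-suc i j × lookup vs i ≡ u × lookup vs j ≡ w

  -- vs lists the vertices of K in cyclic order.
  IsCycle : ℕ → Graph n → Set
  IsCycle {n} ℓ K = 3 ≤ ℓ × ∃ λ (vs : Vec (Fin n) ℓ) → Unique vs
    × (∀ u → u ∈ V K ⇔ u VecMem.∈ vs)
    × (∀ u w → u ~[ K ] w ⇔ (Consecutive vs u w ⊎ Consecutive vs w u))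

  isCycle? : ∀ ℓ (K : Graph n) → Dec (IsCycle ℓ K)
  isCycle? {n} ℓ K = (3 ≤? ℓ) ×-dec searchVec (allFin n)
    (λ vs → AllPairsᵛ.allPairs? (λ u w → ¬? (u Finₚ.≟ w)) vs
      ×-dec (Finₚ.all? λ u → (u ∈? V K) ⇔-dec (u ∈ᵛ? vs))
      ×-dec (Finₚ.all? λ u → Finₚ.all? λ w → (u ~?[ K ] w) ⇔-dec (consecutive? vs u w ⊎-dec consecutive? vs w u)))
    (λ vs i _ → ∈ₚ.∈-allFin (lookup vs i))
    where
    open DecVec (Finₚ._≟_ {n}) using () renaming (_∈?_ to _∈ᵛ?_)
    infix 2 _⇔-dec_
    _⇔-dec_ : {A B : Set} → Dec A → Dec B → Dec (A ⇔ B)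
    a? ⇔-dec b? = Dec.map′ (λ (f , g) → mk⇔ f g) (λ e → Equivalence.to e , Equivalence.from e)
                           ((a? →-dec b?) ×-dec (b? →-dec a?))
    consecutive? : (vs : Vec (Fin n) ℓ) → ∀ u w → Dec (Consecutive vs u w)
    consecutive? vs u w = Finₚ.any? λ i → Finₚ.any? λ j →
      ((toℕ j ≟ suc (toℕ i)) ⊎-dec ((suc (toℕ i) ≟ ℓ) ×-dec (toℕ j ≟ 0)))
      ×-dec (lookup vs i Finₚ.≟ u) ×-dec (lookup vs j Finₚ.≟ w)

  -- Since graphs n lists every graph on the labels exactly once (∈-graphs, graphs-!), each cycle
  -- of G is counted once, whatever its starting point or orientation.
  C : ℕ → Graph n → ℕ
  C {n} ℓ G = length (filter (λ K → (K ⊑? G) ×-dec isCycle? ℓ K) (graphs n))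

  -- girth H ≥ r: no cycle of H is shorter than r.  This holds vacuously for a forest.
  Girth≥ : ℕ → Graph n → Set
  Girth≥ r H = ∀ ℓ K → K ⊑ H → IsCycle ℓ K → r ≤ ℓ

  girth≥? : ∀ r (H : Graph n) → Dec (Girth≥ r H)
  girth≥? {n} r H = Dec.map′
    (λ none ℓ K K⊑H cyc → ℕₚ.≮⇒≥ λ ℓ<r → All.lookup (none ℓ<r) (∈-graphs K) (K⊑H , cyc))
    (λ girth {ℓ} ℓ<r → All.tabulate λ {K} _ (K⊑H , cyc) → ℕₚ.<⇒≱ ℓ<r (girth ℓ K K⊑H cyc))
    (ℕₚ.allUpTo? (λ ℓ → All.all? (λ K → ¬? ((K ⊑? H) ×-dec isCycle? ℓ K)) (graphs n)) r)

  -- Labels that are not vertices of H may take any colour.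
  Colourable : ℕ → Graph n → Set
  Colourable {n} k H = ∃ λ (f : Fin n → ℕ) → (∀ u → u ∈ V H → f u < k) × (∀ u v → u ~[ H ] v → f u ≢ f v)

  colourable? : ∀ k (H : Graph n) → Dec (Colourable k H)
  colourable? {n} k H = Dec.map′
    (λ (c , _ , c<k , proper) → lookup c , c<k , proper)
    normalise
    (searchVec (upTo (suc k))
      (λ c → (Finₚ.all? λ u → lookup c u <? suc k)
        ×-dec (Finₚ.all? λ u → (u ∈? V H) →-dec (lookup c u <? k))
        ×-dec (Finₚ.all? λ u → Finₚ.all? λ v → (u ~?[ H ] v) →-dec ¬? (lookup c u ≟ lookup c v)))
      (λ c u (c≤k , _) → ∈ₚ.∈-upTo⁺ (c≤k u)))
    where
    normalise : Colourable k H → ∃ λ c → (∀ u → lookup c u < suc k) × (∀ u → u ∈ V H → lookup c u < k)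
                                       × (∀ u v → u ~[ H ] v → lookup c u ≢ lookup c v)
    normalise (f , f<k , proper) = tabulate g
      , (λ u → subst (_< suc k) (sym (Vecₚ.lookup∘tabulate g u)) (g≤k u))
      , (λ u u∈V → subst (_< k) (sym (trans (Vecₚ.lookup∘tabulate g u) (g≡f u u∈V))) (f<k u u∈V))
      , (λ u v uv eq → proper u v uv (trans (sym (lookup≡f u v uv)) (trans eq (lookup≡f v u (proj₁ (simple H) u v uv)))))
      where
      g : Fin n → ℕ
      g u with u ∈? V H
      ... | yes _ = f u
      ... | no  _ = 0
      g≤k : ∀ u → g u < suc k
      g≤k u with u ∈? V H
      ... | yes u∈V = ℕₚ.m≤n⇒m≤1+n (f<k u u∈V)
      ... | no  _   = s≤s z≤n
      g≡f : ∀ u → u ∈ V H → g u ≡ f u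
      g≡f u u∈V with u ∈? V H
      ... | yes _  = refl
      ... | no u∉V = ⊥-elim (u∉V u∈V)
      lookup≡f : ∀ u v → u ~[ H ] v → lookup (tabulate g) u ≡ f u
      lookup≡f u v uv = trans (Vecₚ.lookup∘tabulate g u) (g≡f u (proj₂ (proj₂ (simple H)) u v uv))

  -- The least k such that H is k-colourable; k = n always works.
  χ : Graph n → ℕ
  χ {n} H = min n (filter (λ k → colourable? k H) (upTo n))

  χ-colourable : (H : Graph n) → Colourable (χ H) H
  χ-colourable {n} H = Extrema.argmin-all (λ k → k) {P = λ k → Colourable k H}
    (toℕ , (λ u _ → Finₚ.toℕ<n u) , λ u v uv eq → proj₁ (proj₂ (simple H)) u (subst (λ w → u ~[ H ] w) (sym (Finₚ.toℕ-injective eq)) uv))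
    (All.tabulate λ k∈ → proj₂ (∈ₚ.∈-filter⁻ (λ k → colourable? k H) {xs = upTo n} k∈))

  χ-minimal : ∀ k (H : Graph n) → Colourable k H → χ H ≤ k
  χ-minimal {n} k H col with k <? n
  ... | yes k<n = Extrema.min≤v⁺ n _ (inj₂ (ListMem.lose (∈ₚ.∈-filter⁺ (λ k → colourable? k H) (∈ₚ.∈-upTo⁺ k<n) col) ℕₚ.≤-refl))
  ... | no  k≮n = Extrema.min≤v⁺ n (filter (λ k → colourable? k H) (upTo n)) (inj₁ (ℕₚ.≮⇒≥ k≮n))

  -- The list is never empty, since it contains the graph without vertices.
  h : ℕ → Graph n → ℕ
  h {n} r G = max 0 (List.map χ (filter (λ H → (H ⊑? G) ×-dec girth≥? r H) (graphs n)))

  h-upper : ∀ r (G H : Graph n) → H ⊑ G → Girth≥ r H → χ H ≤ h r G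
  h-upper {n} r G H H⊑G girth = Extrema.v≤max⁺ 0 _ (inj₂ (ListMem.lose
    (∈ₚ.∈-map⁺ χ (∈ₚ.∈-filter⁺ (λ H → (H ⊑? G) ×-dec girth≥? r H) (∈-graphs H) (H⊑G , girth))) ℕₚ.≤-refl))

  h-attained : ∀ r (G : Graph n) → ∃ λ H → H ⊑ G × Girth≥ r H × χ H ≡ h r G
  h-attained {n} r G = attained (Extrema.argmax-sel (λ k → k) 0 (List.map χ (filter P? (graphs n))))
    where
    P? : (H : Graph n) → Dec (H ⊑ G × Girth≥ r H)
    P? H = (H ⊑? G) ×-dec girth≥? r H
    no-edge : ∀ u v → ¬ v ∈ lookup (Vec.replicate n (⊥ {n})) u
    no-edge u v v∈ = ∉⊥ (subst (v ∈_) (Vecₚ.lookup-replicate u ⊥) v∈)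
    empty : Graph n
    empty = mkGraph ⊥ (Vec.replicate n ⊥)
      ( (λ u v uv → ⊥-elim (no-edge u v uv)) , (λ v → no-edge v v) , (λ u v uv → ⊥-elim (no-edge u v uv)))
    empty⊆ : V empty ⊆ V G
    empty⊆ u∈ = ⊥-elim (∉⊥ u∈)
    no-cycle : Girth≥ r empty
    no-cycle _ K (K⊆ , _) (s≤s _ , u ∷ _ , _ , vertices , _) =
      ⊥-elim (∉⊥ (K⊆ (Equivalence.from (vertices u) (Anyᵛ.here refl))))
    attained : ∀ {k} → k ≡ 0 ⊎ k ListMem.∈ List.map χ (filter P? (graphs n)) → ∃ λ H → H ⊑ G × Girth≥ r H × χ H ≡ k
    attained (inj₂ k∈) =
      let H , H∈ , eq = ∈ₚ.∈-map⁻ χ k∈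
          _ , H⊑G , girth = ∈ₚ.∈-filter⁻ P? {xs = graphs n} H∈
      in H , H⊑G , girth , sym eq
    attained (inj₁ k≡0) = empty , (empty⊆ , λ u v uv → ⊥-elim (no-edge u v uv)) , no-cycle
      , trans (ℕₚ.n≤0⇒n≡0 (χ-minimal 0 empty ((λ _ → 0) , (λ u u∈ → ⊥-elim (∉⊥ u∈)) , λ u v uv → ⊥-elim (no-edge u v uv))))
              (sym k≡0)

module Reals where

  open import Algebra.Bundles using (CommutativeRing)
  open import Data.Integer as ℤ using (ℤ)
  import Data.Integer.Properties as ℤₚ
  open import Data.Nat as ℕ using (ℕ; zero; suc)
  import Data.Nat.Solver as ℕS
  open import Data.Rational
  open import Data.Rational.Literals using (fromℤ)
  open import Data.Rational.Properties
  open import Data.Rational.Solver using (module +-*-Solver)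
  open import Data.Rational.Unnormalised using (mkℚᵘ; *≡*)
  open import Algebra.Properties.CommutativeSemiring.Exp
    (CommutativeRing.commutativeSemiring +-*-commutativeRing) using (_^_; ^-homo-*; ^-assocʳ; ^-distrib-*)

  open +-*-Solver using (solve; _:+_; _:*_; _:-_; :-_; _:=_)

  private variable p q s t a a′ b b′ c d e e′ : ℚ

  ι : ℕ → ℚ
  ι n = fromℤ (ℤ.+ n)

  fromℤ-+ : ∀ i j → fromℤ (i ℤ.+ j) ≡ fromℤ i + fromℤ j
  fromℤ-+ i j = sym (trans (cong (_/ 1) (cong₂ ℤ._+_ (ℤₚ.*-identityʳ i) (ℤₚ.*-identityʳ j)))
                           (↥p/↧p≡p (fromℤ (i ℤ.+ j))))

  fromℤ-* : ∀ i j → fromℤ (i ℤ.* j) ≡ fromℤ i * fromℤ j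
  fromℤ-* i j = sym (↥p/↧p≡p (fromℤ (i ℤ.* j)))

  ι-+ : ∀ m n → ι (m ℕ.+ n) ≡ ι m + ι n
  ι-+ m n = fromℤ-+ (ℤ.+ m) (ℤ.+ n)

  ι-* : ∀ m n → ι (m ℕ.* n) ≡ ι m * ι n
  ι-* m n = trans (cong fromℤ (ℤₚ.pos-* m n)) (fromℤ-* (ℤ.+ m) (ℤ.+ n))

  ι-mono : ∀ {m n} → m ℕ.≤ n → ι m ≤ ι n
  ι-mono m≤n = *≤* (ℤₚ.*-monoʳ-≤-nonNeg (ℤ.+ 1) (ℤ.+≤+ m≤n))

  ι-cancel : ∀ {m n} → ι m ≤ ι n → m ℕ.≤ n
  ι-cancel (*≤* m≤n) = ℤₚ.drop‿+≤+ (ℤₚ.*-cancelʳ-≤-pos _ _ (ℤ.+ 1) m≤n)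

  0≤ι : ∀ n → 0ℚ ≤ ι n
  0≤ι n = ι-mono {0} {n} ℕ.z≤n

  numeratorIdentity : ∀ e → e * fromℤ (↧ e) ≡ fromℤ (↥ e)
  numeratorIdentity e@(mkℚ n d _) = trans
    (fromℚᵘ-cong {mkℚᵘ (n ℤ.* (↧ e)) (d ℕ.* 1)} {mkℚᵘ n 0}
      (*≡* (trans (ℤₚ.*-identityʳ _) (cong (λ z → n ℤ.* (ℤ.+ suc z)) (sym (ℕₚ.*-identityʳ d))))))
    (↥p/↧p≡p (fromℤ n))

  *-mono-≤ : 0ℚ ≤ a → a ≤ b → 0ℚ ≤ c → c ≤ d → a * c ≤ b * d
  *-mono-≤ {a} {b} {c} {d} 0≤a a≤b 0≤c c≤d = ≤-trans
    (*-monoʳ-≤-nonNeg c {{nonNegative 0≤c}} a≤b)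
    (*-monoˡ-≤-nonNeg b {{nonNegative (≤-trans 0≤a a≤b)}} c≤d)

  0≤* : 0ℚ ≤ a → 0ℚ ≤ b → 0ℚ ≤ a * b
  0≤* {a} {b} 0≤a 0≤b = nonNegative⁻¹ _ {{nonNeg*nonNeg⇒nonNeg a {{nonNegative 0≤a}} b {{nonNegative 0≤b}}}}

  0<* : 0ℚ < a → 0ℚ < b → 0ℚ < a * b
  0<* {a} {b} 0<a 0<b = positive⁻¹ _ {{pos*pos⇒pos a {{positive 0<a}} b {{positive 0<b}}}}

  0≤^ : ∀ n → 0ℚ ≤ a → 0ℚ ≤ a ^ n
  0≤^ zero    0≤a = nonNegative⁻¹ 1ℚ
  0≤^ (suc n) 0≤a = 0≤* 0≤a (0≤^ n 0≤a)

  0<^ : ∀ n → 0ℚ < a → 0ℚ < a ^ n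
  0<^ zero    0<a = positive⁻¹ 1ℚ
  0<^ (suc n) 0<a = 0<* 0<a (0<^ n 0<a)

  ^-mono : ∀ n → 0ℚ ≤ a → a ≤ b → a ^ n ≤ b ^ n
  ^-mono zero    0≤a a≤b = ≤-refl
  ^-mono (suc n) 0≤a a≤b = *-mono-≤ 0≤a a≤b (0≤^ n 0≤a) (^-mono n 0≤a a≤b)

  ^-mono-< : ∀ n → 0ℚ ≤ a → a < b → a ^ suc n < b ^ suc n
  ^-mono-< {a} {b} n 0≤a a<b = ≤-<-trans
    (*-monoˡ-≤-nonNeg a {{nonNegative 0≤a}} (^-mono n 0≤a (<⇒≤ a<b)))
    (*-monoˡ-<-pos (b ^ n) {{positive (0<^ n (≤-<-trans 0≤a a<b))}} a<b)

  ^-mono-exp : ∀ {m n} → 1ℚ ≤ a → m ℕ.≤ n → a ^ m ≤ a ^ n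
  ^-mono-exp {a} {n = n} 1≤a ℕ.z≤n = go n where
    go : ∀ n → 1ℚ ≤ a ^ n
    go zero    = ≤-refl
    go (suc n) = *-mono-≤ {1ℚ} {a} {1ℚ} {a ^ n} (nonNegative⁻¹ 1ℚ) 1≤a (nonNegative⁻¹ 1ℚ) (go n)
  ^-mono-exp {a} 1≤a (ℕ.s≤s m≤n) =
    *-monoˡ-≤-nonNeg a {{nonNegative (≤-trans (nonNegative⁻¹ 1ℚ) 1≤a)}} (^-mono-exp 1≤a m≤n)

  1^ : ∀ n → 1ℚ ^ n ≡ 1ℚ
  1^ zero = refl
  1^ (suc n) = trans (*-identityˡ _) (1^ n)

  below : p < q → 0ℚ < q - p
  below {p} {q} p<q = subst (_< q - p) (+-inverseʳ p) (+-monoˡ-< (- p) p<q)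

  archimedean : ∀ q → ∃ λ N → q < ι N
  archimedean q@(mkℚ (ℤ.+ n) d _)   = suc n , *<* (begin-strict
      ℤ.+ n ℤ.* ℤ.+ 1          ≡⟨ ℤₚ.*-identityʳ (ℤ.+ n) ⟩
      ℤ.+ n                  <⟨ ℤ.+<+ (ℕₚ.n<1+n n) ⟩
      ℤ.+ suc n              ≤⟨ ℤ.+≤+ (ℕₚ.m≤m*n (suc n) (suc d)) ⟩
      ℤ.+ (suc n ℕ.* suc d)  ≡⟨ ℤₚ.pos-* (suc n) (suc d) ⟩
      ℤ.+ suc n ℤ.* ℤ.+ suc d  ∎)
    where open ℤₚ.≤-Reasoning
  archimedean q@(mkℚ ℤ.-[1+ _ ] _ _) = 0 , negative⁻¹ q

  archimedean* : ∀ q → 0ℚ < d → ∃ λ N → q < ι N * d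
  archimedean* {d} q 0<d = let instance _ = positive 0<d; instance _ = pos⇒nonZero d
                               N , lt = archimedean (q * 1/ d)
    in N , subst (_< ι N * d) (trans (*-assoc q (1/ d) d) (trans (cong (q *_) (*-inverseˡ d)) (*-identityʳ q)))
             (*-monoˡ-<-pos d lt)

  infixl 6 _+ʳ_ _-ʳ_
  infixl 7 _÷ʳ_
  infixl 7 _⊓ʳ_

  -- Two-sided Dedekind cuts: L x q means q < x, and U x q means x < q.
  record ℝ : Set₁ where
    field
      L U       : ℚ → Set
      inhabited : ∃ L × ∃ U
      L-down    : p < q → L q → L p
      L-open    : L p → ∃ λ q → p < q × L q
      U-up      : p < q → U p → U q
      U-open    : U q → ∃ λ p → p < q × U p
      disjoint  : L p → ¬ U p
      located   : p < q → L p ⊎ U q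

    L<U : L p → U q → p < q
    L<U {p} {q} Lp Uq with p <? q
    ... | yes p<q = p<q
    ... | no  p≮q with L-open Lp
    ...   | r , p<r , Lr = ⊥-elim (disjoint Lr (U-up (≤-<-trans (≮⇒≥ p≮q) p<r) Uq))

  open ℝ

  infix 4 _≤ʳ_ _<ʳ_

  _≤ʳ_ : ℝ → ℝ → Set
  x ≤ʳ y = ∀ q → L x q → L y q

  _<ʳ_ : ℝ → ℝ → Set
  x <ʳ y = ∃ λ q → U x q × L y q

  q-1<q : ∀ q → q - 1ℚ < q
  q-1<q q = subst (q - 1ℚ <_) (+-identityʳ q) (+-monoʳ-< q (negative⁻¹ (- 1ℚ)))

  q<q+1 : ∀ q → q < q + 1ℚ
  q<q+1 q = subst (_< q + 1ℚ) (+-identityʳ q) (+-monoʳ-< q (positive⁻¹ 1ℚ))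

  fromℚ : ℚ → ℝ
  fromℚ r = record
    { L         = _< r
    ; U         = r <_
    ; inhabited = (_ , q-1<q r) , (_ , q<q+1 r)
    ; L-down    = <-trans
    ; L-open    = <-dense
    ; U-up      = λ p<q r<p → <-trans r<p p<q
    ; U-open    = λ r<q → let p , r<p , p<q = <-dense r<q in p , p<q , r<p
    ; disjoint  = <-asym
    ; located   = loc
    }
    where
    loc : p < q → p < r ⊎ r < q
    loc {p} p<q with p <? r
    ... | yes p<r = inj₁ p<r
    ... | no  p≮r = inj₂ (≤-<-trans (≮⇒≥ p≮r) p<q)

  fromℕ : ℕ → ℝ
  fromℕ n = fromℚ (ι n)

  half : 0ℚ < d → ∃ λ h → 0ℚ < h × h + h ≡ d
  half {d} 0<d = d * ½ , 0<* 0<d (positive⁻¹ ½) , trans (sym (*-distribˡ-+ d ½ ½)) (*-identityʳ d)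

  multiple : ℕ → ℚ → ℚ
  multiple zero    h = 0ℚ
  multiple (suc n) h = h + multiple n h

  multiple≡ : ∀ n h → multiple n h ≡ ι n * h
  multiple≡ zero    h = sym (*-zeroˡ h)
  multiple≡ (suc n) h = trans (cong₂ _+_ (sym (*-identityˡ h)) (multiple≡ n h))
                              (trans (sym (*-distribʳ-+ h 1ℚ (ι n))) (cong (λ z → z * h) (sym (ι-+ 1 n))))

  approximate : ∀ x → 0ℚ < d → ∃ λ a → L x a × U x (a + d)
  approximate {d} x 0<d = approximateʰ (half 0<d)
    where
    approximateʰ : (∃ λ h → 0ℚ < h × h + h ≡ d) → ∃ λ a → L x a × U x (a + d)
    approximateʰ (h , 0<h , h+h≡d) =
      let (a , La) , (b , Ub) = inhabited x
          N , b-a<Nh = archimedean* (b - a) 0<h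
      in walk N a La (U-up x (subst₂ _<_ (solve 2 (λ a b → a :+ (b :- a) := b) refl a b)
                                         (cong (λ z → a + z) (sym (multiple≡ N h)))
                                         (+-monoʳ-< a b-a<Nh)) Ub)
      where
      walk : ∀ N a → L x a → U x (a + multiple N h) → ∃ λ a → L x a × U x (a + d)
      walk zero    a La Ua = ⊥-elim (disjoint x La (subst (U x) (+-identityʳ a) Ua))
      walk (suc N) a La Ua =
        [ (λ La+h → walk N (a + h) La+h (subst (U x) (sym (+-assoc a h (multiple N h))) Ua))
        , (λ Ua+h+h → a , La , subst (U x) (trans (+-assoc a h h) (cong (λ z → a + z) h+h≡d)) Ua+h+h)
        ]′ (located x (subst (_< a + h + h) (+-identityʳ (a + h)) (+-monoʳ-< (a + h) 0<h)))

  decide : {A B : Set} → (p < q → A) → (q ≤ p → B) → A ⊎ B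
  decide {p} {q} f g with p <? q
  ... | yes p<q = inj₁ (f p<q)
  ... | no  p≮q = inj₂ (g (≮⇒≥ p≮q))

  negʳ : ℝ → ℝ
  negʳ x = record
    { L         = λ q → U x (- q)
    ; U         = λ q → L x (- q)
    ; inhabited = let (l , Ll) , (u , Uu) = inhabited x
                  in (- u , subst (U x) (neg² u) Uu) , (- l , subst (L x) (neg² l) Ll)
    ; L-down    = λ p<q → U-up x (neg-antimono-< p<q)
    ; L-open    = λ {p} U-p → let q , q<-p , Uq = U-open x U-p
                              in - q , subst (_< - q) (sym (neg² p)) (neg-antimono-< q<-p) , subst (U x) (neg² q) Uq
    ; U-up      = λ p<q → L-down x (neg-antimono-< p<q)
    ; U-open    = λ {q} L-q → let p , -q<p , Lp = L-open x L-q
                              in - p , subst (- p <_) (sym (neg² q)) (neg-antimono-< -q<p) , subst (L x) (neg² p) Lp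
    ; disjoint  = λ Up Lp → disjoint x Lp Up
    ; located   = λ p<q → [ inj₂ , inj₁ ]′ (located x (neg-antimono-< p<q))
    }
    where
    neg² : ∀ q → q ≡ - - q
    neg² = solve 1 (λ q → q := :- :- q) refl

  _+ʳ_ : ℝ → ℝ → ℝ
  x +ʳ y = record
    { L         = λ q → ∃₂ λ a b → L x a × L y b × q < a + b
    ; U         = λ q → ∃₂ λ a b → U x a × U y b × a + b < q
    ; inhabited = let (a , La) , (a′ , Ua) = inhabited x
                      (b , Lb) , (b′ , Ub) = inhabited y
                  in (_ , a , b , La , Lb , q-1<q (a + b)) , (_ , a′ , b′ , Ua , Ub , q<q+1 (a′ + b′))
    ; L-down    = λ p<q (a , b , La , Lb , lt) → a , b , La , Lb , <-trans p<q lt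
    ; L-open    = λ (a , b , La , Lb , lt) → let q , l , u = <-dense lt in q , l , a , b , La , Lb , u
    ; U-up      = λ p<q (a , b , Ua , Ub , lt) → a , b , Ua , Ub , <-trans lt p<q
    ; U-open    = λ (a , b , Ua , Ub , lt) → let q , l , u = <-dense lt in q , u , a , b , Ua , Ub , l
    ; disjoint  = λ (a , b , La , Lb , l) (a′ , b′ , Ua , Ub , u) →
                    <-asym (<-trans l (+-mono-< (L<U x La Ua) (L<U y Lb Ub))) u
    ; located   = loc
    }
    where
    loc : p < q → (∃₂ λ a b → L x a × L y b × p < a + b) ⊎ (∃₂ λ a b → U x a × U y b × a + b < q)
    loc {p} {q} p<q =
      let δ , 0<δ , δ<q-p  = <-dense (below p<q)
          h , 0<h , h+h≡δ  = half 0<δ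
          a , La , Ua      = approximate x 0<h
          b , Lb , Ub      = approximate y 0<h
      in decide (λ p<a+b → a , b , La , Lb , p<a+b)
                (λ a+b≤p → a + h , b + h , Ua , Ub , subst₂ _<_
                  (trans (cong (λ z → a + b + z) (sym h+h≡δ))
                         (solve 3 (λ a b h → a :+ b :+ (h :+ h) := a :+ h :+ (b :+ h)) refl a b h))
                  (solve 2 (λ p q → p :+ (q :- p) := q) refl p q)
                  (+-mono-≤-< a+b≤p δ<q-p))

  _-ʳ_ : ℝ → ℝ → ℝ
  x -ʳ y = x +ʳ negʳ y

  _⊓ʳ_ : ℝ → ℝ → ℝ
  x ⊓ʳ y = record
    { L         = λ q → L x q × L y q
    ; U         = λ q → U x q ⊎ U y q
    ; inhabited = inh , (let _ , (u , Uu) = inhabited x in u , inj₁ Uu)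
    ; L-down    = λ p<q (Lx , Ly) → L-down x p<q Lx , L-down y p<q Ly
    ; L-open    = λ {p} (Lx , Ly) → let a , p<a , La = L-open x Lx; b , p<b , Lb = L-open y Ly
                                    in both p<a La p<b Lb
    ; U-up      = λ p<q → [ (λ Ux → inj₁ (U-up x p<q Ux)) , (λ Uy → inj₂ (U-up y p<q Uy)) ]′
    ; U-open    = [ (λ Ux → let p , p<q , Up = U-open x Ux in p , p<q , inj₁ Up)
                  , (λ Uy → let p , p<q , Up = U-open y Uy in p , p<q , inj₂ Up) ]′
    ; disjoint  = λ (Lx , Ly) → [ disjoint x Lx , disjoint y Ly ]′
    ; located   = λ p<q → [ (λ Lx → [ (λ Ly → inj₁ (Lx , Ly)) , (λ Uy → inj₂ (inj₂ Uy)) ]′ (located y p<q))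
                          , (λ Ux → inj₂ (inj₁ Ux)) ]′ (located x p<q)
    }
    where
    both : p < a → L x a → p < b → L y b → ∃ λ q → p < q × L x q × L y q
    both {p} {a} {b} p<a La p<b Lb with a ≤? b
    ... | yes a≤b = let c , p<c , c<a = <-dense p<a
                    in c , p<c , L-down x c<a La , L-down y (<-≤-trans c<a a≤b) Lb
    ... | no  a≰b = b , p<b , L-down x (≰⇒> a≰b) La , Lb
    inh : ∃ λ q → L x q × L y q
    inh with (a , La) , _ ← inhabited x | (b , Lb) , _ ← inhabited y with a <? b
    ... | yes a<b = a , La , L-down y a<b Lb
    ... | no  a≮b = let c = b - 1ℚ; c<b = q-1<q b
                    in c , L-down x (<-≤-trans c<b (≮⇒≥ a≮b)) La , L-down y c<b Lb

  _÷ʳ_ : ℝ → (k : ℕ) .{{_ : ℕ.NonZero k}} → ℝ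
  _÷ʳ_ x k@(suc k-1) = record
    { L         = λ q → L x (q * ι k)
    ; U         = λ q → U x (q * ι k)
    ; inhabited = let (l , Ll) , (u , Uu) = inhabited x
                  in (l * k⁻¹ , subst (L x) (cancel l) Ll) , (u * k⁻¹ , subst (U x) (cancel u) Uu)
    ; L-down    = λ p<q → L-down x (*-monoˡ-<-pos (ι k) p<q)
    ; L-open    = λ Lp → let q , p<q , Lq = L-open x Lp
                         in q * k⁻¹ , *-cancelʳ-<-nonNeg (ι k) (subst (_ <_) (cancel q) p<q) , subst (L x) (cancel q) Lq
    ; U-up      = λ p<q → U-up x (*-monoˡ-<-pos (ι k) p<q)
    ; U-open    = λ Uq → let p , p<q , Up = U-open x Uq
                         in p * k⁻¹ , *-cancelʳ-<-nonNeg (ι k) (subst (_< _) (cancel p) p<q) , subst (U x) (cancel p) Up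
    ; disjoint  = disjoint x
    ; located   = λ p<q → located x (*-monoˡ-<-pos (ι k) p<q)
    }
    where
    k⁻¹ = 1/ (ι k)
    cancel : ∀ q → q ≡ q * k⁻¹ * ι k
    cancel q = sym (trans (*-assoc q k⁻¹ (ι k)) (trans (cong (q *_) (*-inverseˡ (ι k))) (*-identityʳ q)))

  -- q is below (above) the products of the endpoints of the intervals [a , a′] and [b , b′].
  AllBelow AllAbove : ℚ → ℚ → ℚ → ℚ → ℚ → Set
  AllBelow q a a′ b b′ = q < a * b × q < a * b′ × q < a′ * b × q < a′ * b′
  AllAbove q a a′ b b′ = a * b < q × a * b′ < q × a′ * b < q × a′ * b′ < q

  segment< : a ≤ t → t ≤ a′ → q < a * c → q < a′ * c → q < t * c
  segment< {a} {t} {a′} {q} {c} a≤t t≤a′ q<ac q<a′c with 0ℚ ≤? c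
  ... | yes 0≤c = <-≤-trans q<ac (*-monoʳ-≤-nonNeg c {{nonNegative 0≤c}} a≤t)
  ... | no  0≰c = <-≤-trans q<a′c (*-monoʳ-≤-nonPos c {{nonPositive (<⇒≤ (≰⇒> 0≰c))}} t≤a′)

  box< : a ≤ t → t ≤ a′ → b ≤ s → s ≤ b′ → AllBelow q a a′ b b′ → q < t * s
  box< {a} {t} {a′} {b} {s} {b′} {q} a≤t t≤a′ b≤s s≤b′ (ab , ab′ , a′b , a′b′) =
    subst (q <_) (*-comm s t) (segment< b≤s s≤b′
      (subst (q <_) (*-comm t b)  (segment< a≤t t≤a′ ab  a′b))
      (subst (q <_) (*-comm t b′) (segment< a≤t t≤a′ ab′ a′b′)))

  box> : a ≤ t → t ≤ a′ → b ≤ s → s ≤ b′ → AllAbove q a a′ b b′ → t * s < q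
  box> {a} {t} {a′} {b} {s} {b′} {q} a≤t t≤a′ b≤s s≤b′ (ab , ab′ , a′b , a′b′) =
    neg-cancel (subst (- q <_) (flip t s)
      (box< (neg-antimono-≤ t≤a′) (neg-antimono-≤ a≤t) b≤s s≤b′ (negate a′ b a′b , negate a′ b′ a′b′ , negate a b ab , negate a b′ ab′)))
    where
    flip : ∀ u v → - u * v ≡ - (u * v)
    flip u v = sym (neg-distribˡ-* u v)
    negate : ∀ u v → u * v < q → - q < - u * v
    negate u v lt = subst (- q <_) (sym (flip u v)) (neg-antimono-< lt)
    neg-cancel : - c < - d → d < c
    neg-cancel {c} {d} lt = subst₂ _<_ (neg² d) (neg² c) (neg-antimono-< lt)
      where neg² = solve 1 (λ q → :- :- q := q) refl

  smallFactor : ∀ {K e} → 0ℚ < K → 0ℚ < e → ∃ λ δ → 0ℚ < δ × δ ≤ 1ℚ × K * δ < e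
  smallFactor {K} {e} 0<K 0<e = e * ρ , 0<δ , <⇒≤ er<1 ,
    subst₂ _<_ (solve 3 (λ e K ρ → e :* (K :* ρ) := K :* (e :* ρ)) refl e K ρ) (*-identityʳ e)
      (*-monoʳ-<-pos e {{positive 0<e}} Kr<1)
    where
    0<e+K : 0ℚ < e + K
    0<e+K = +-mono-< 0<e 0<K
    instance _ = positive 0<e+K; _ = pos⇒nonZero (e + K)
    ρ = 1/ (e + K)
    0<ρ : 0ℚ < ρ
    0<ρ = positive⁻¹ ρ {{1/pos⇒pos (e + K)}}
    0<δ = 0<* 0<e 0<ρ
    sum≡1 : e * ρ + K * ρ ≡ 1ℚ
    sum≡1 = trans (sym (*-distribʳ-+ ρ e K)) (*-inverseʳ (e + K))
    er<1 : e * ρ < 1ℚ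
    er<1 = subst₂ _<_ (+-identityʳ (e * ρ)) sum≡1 (+-monoʳ-< (e * ρ) (0<* 0<K 0<ρ))
    Kr<1 : K * ρ < 1ℚ
    Kr<1 = subst₂ _<_ (+-identityˡ (K * ρ)) sum≡1 (+-monoˡ-< (K * ρ) 0<δ)

  approximantsBounded : ∀ x → ∃ λ B → 0ℚ ≤ B × (∀ {a δ} → δ ≤ 1ℚ → L x a → U x (a + δ) → - B ≤ a × a ≤ B)
  approximantsBounded x =
    let (l , Ll) , (u , Uu) = inhabited x
        m , u<m             = archimedean u
        n , 1-l<n           = archimedean (1ℚ - l)
    in bound Ll Uu (0≤ι m) (0≤ι n) u<m 1-l<n
    where
    lower : ∀ {l N a δ} → 1ℚ - l < N → δ ≤ 1ℚ → l < a + δ → - N < a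
    lower {l} {N} {a} {δ} 1-l<N δ≤1 l<a+δ = subst₂ _<_
      (solve 3 (λ i l n → i :- l :+ l :- n :- i := :- n) refl 1ℚ l N)
      (solve 3 (λ n a i → n :+ (a :+ i) :- n :- i := a) refl N a 1ℚ)
      (+-monoˡ-< (- 1ℚ) (+-monoˡ-< (- N) (+-mono-< 1-l<N (<-≤-trans l<a+δ (+-monoʳ-≤ a δ≤1)))))

    bound : ∀ {l u M N} → L x l → U x u → 0ℚ ≤ M → 0ℚ ≤ N → u < M → 1ℚ - l < N →
            ∃ λ B → 0ℚ ≤ B × (∀ {a δ} → δ ≤ 1ℚ → L x a → U x (a + δ) → - B ≤ a × a ≤ B)
    bound {M = M} {N} Ll Uu 0≤M 0≤N u<M 1-l<N = M + N , +-mono-≤ 0≤M 0≤N , λ δ≤1 La Ua →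
        ≤-trans (neg-antimono-≤ (subst (_≤ M + N) (+-identityˡ N) (+-monoˡ-≤ N 0≤M)))
                (<⇒≤ (lower 1-l<N δ≤1 (L<U x Ll Ua)))
      , ≤-trans (<⇒≤ (<-trans (L<U x La Uu) u<M)) (subst (_≤ M + N) (+-identityʳ M) (+-monoʳ-≤ M 0≤N))

  Within : ℚ → ℚ → ℚ → ℚ → ℚ → Set
  Within a a′ b b′ η = in-range (a * b) × in-range (a * b′) × in-range (a′ * b) × in-range (a′ * b′)
    where
    in-range : ℚ → Set
    in-range c = a * b - η ≤ c × c ≤ a * b + η

  -- All four corner products lie within (B + C + 1) δ of a * b.
  corners : ∀ {B C δ} → 0ℚ < δ → δ ≤ 1ℚ → 0ℚ ≤ B → 0ℚ ≤ C → - B ≤ a × a ≤ B → - C ≤ b × b ≤ C →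
            Within a (a + δ) b (b + δ) ((B + C + 1ℚ) * δ)
  corners {a} {b} {B} {C} {δ} 0<δ δ≤1 0≤B 0≤C (-B≤a , a≤B) (-C≤b , b≤C) =
      near 0ℚ (neg≤0 , 0≤K) (trans (cong (λ z → a * b + z) (*-zeroˡ δ)) (+-identityʳ (a * b)))
    , near a  (≤-trans (neg-antimono-≤ B≤K) -B≤a , ≤-trans a≤B B≤K)
        (solve 3 (λ a b d → a :* b :+ a :* d := a :* (b :+ d)) refl a b δ)
    , near b  (≤-trans (neg-antimono-≤ C≤K) -C≤b , ≤-trans b≤C C≤K)
        (solve 3 (λ a b d → a :* b :+ b :* d := (a :+ d) :* b) refl a b δ)
    , near (a + b + δ)
        ( ≤-trans (neg-antimono-≤ BC≤K)
            (subst₂ _≤_ (trans (+-identityʳ _) (sym (neg-distrib-+ B C))) refl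
              (+-mono-≤ (+-mono-≤ -B≤a -C≤b) (<⇒≤ 0<δ)))
        , +-mono-≤ (+-mono-≤ a≤B b≤C) δ≤1)
        (solve 3 (λ a b d → a :* b :+ (a :+ b :+ d) :* d := (a :+ d) :* (b :+ d)) refl a b δ)
    where
    K = B + C + 1ℚ
    0≤1 : 0ℚ ≤ 1ℚ
    0≤1 = nonNegative⁻¹ 1ℚ
    BC≤K : B + C ≤ K
    BC≤K = subst (_≤ K) (+-identityʳ (B + C)) (+-monoʳ-≤ (B + C) 0≤1)
    B≤K : B ≤ K
    B≤K = ≤-trans (subst (_≤ B + C) (+-identityʳ B) (+-monoʳ-≤ B 0≤C)) BC≤K
    C≤K : C ≤ K
    C≤K = ≤-trans (subst (_≤ B + C) (+-identityˡ C) (+-monoˡ-≤ C 0≤B)) BC≤K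
    0≤K : 0ℚ ≤ K
    0≤K = ≤-trans 0≤B B≤K
    neg≤0 : - K ≤ 0ℚ
    neg≤0 = neg-antimono-≤ 0≤K
    near : ∀ t {c} → - K ≤ t × t ≤ K → a * b + t * δ ≡ c → a * b - K * δ ≤ c × c ≤ a * b + K * δ
    near t (-K≤t , t≤K) refl =
        +-monoʳ-≤ (a * b) (subst (_≤ t * δ) (sym (neg-distribˡ-* K δ))
          (*-monoʳ-≤-nonNeg δ {{nonNegative (<⇒≤ 0<δ)}} -K≤t))
      , +-monoʳ-≤ (a * b) (*-monoʳ-≤-nonNeg δ {{nonNegative (<⇒≤ 0<δ)}} t≤K)

  below-corners : ∀ {η} → Within a a′ b b′ η → p < a * b - η → AllBelow p a a′ b b′
  below-corners ((l₁ , _) , (l₂ , _) , (l₃ , _) , (l₄ , _)) lo =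
    <-≤-trans lo l₁ , <-≤-trans lo l₂ , <-≤-trans lo l₃ , <-≤-trans lo l₄

  above-corners : ∀ {η} → Within a a′ b b′ η → a * b + η < q → AllAbove q a a′ b b′
  above-corners ((_ , u₁) , (_ , u₂) , (_ , u₃) , (_ , u₄)) hi =
    ≤-<-trans u₁ hi , ≤-<-trans u₂ hi , ≤-<-trans u₃ hi , ≤-<-trans u₄ hi

  -- Interval multiplication, valid for factors of any sign: q < x y iff x and y lie in open
  -- rational intervals all of whose corner products exceed q.
  infixl 7 _*ʳ_

  _*ʳ_ : ℝ → ℝ → ℝ
  x *ʳ y = record
    { L         = Lo
    ; U         = Up
    ; inhabited = inh
    ; L-down    = λ p<q (a , a′ , b , b′ , A , B , c₁ , c₂ , c₃ , c₄) →
                    a , a′ , b , b′ , A , B , <-trans p<q c₁ , <-trans p<q c₂ , <-trans p<q c₃ , <-trans p<q c₄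
    ; L-open    = λ (a , a′ , b , b′ , A , B , c) → let q , p<q , c′ = room< a a′ b b′ c in q , p<q , a , a′ , b , b′ , A , B , c′
    ; U-up      = λ p<q (a , a′ , b , b′ , A , B , c₁ , c₂ , c₃ , c₄) →
                    a , a′ , b , b′ , A , B , <-trans c₁ p<q , <-trans c₂ p<q , <-trans c₃ p<q , <-trans c₄ p<q
    ; U-open    = λ (a , a′ , b , b′ , A , B , c) → let p , p<q , c′ = room> a a′ b b′ c in p , p<q , a , a′ , b , b′ , A , B , c′
    ; disjoint  = λ (a₁ , a₁′ , b₁ , b₁′ , (La₁ , Ua₁) , (Lb₁ , Ub₁) , c₁)
                    (a₂ , a₂′ , b₂ , b₂′ , (La₂ , Ua₂) , (Lb₂ , Ub₂) , c₂) →
                    let t , Lt , a₁≤t , a₂≤t = common x La₁ La₂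
                        s , Ls , b₁≤s , b₂≤s = common y Lb₁ Lb₂
                    in <-asym (box< a₁≤t (<⇒≤ (L<U x Lt Ua₁)) b₁≤s (<⇒≤ (L<U y Ls Ub₁)) c₁)
                              (box> a₂≤t (<⇒≤ (L<U x Lt Ua₂)) b₂≤s (<⇒≤ (L<U y Ls Ub₂)) c₂)
    ; located   = loc
    }
    where
    Lo Up : ℚ → Set
    Lo q = ∃₂ λ a a′ → ∃₂ λ b b′ → (L x a × U x a′) × (L y b × U y b′) × AllBelow q a a′ b b′
    Up q = ∃₂ λ a a′ → ∃₂ λ b b′ → (L x a × U x a′) × (L y b × U y b′) × AllAbove q a a′ b b′

    common : ∀ z → L z a → L z b → ∃ λ t → L z t × a ≤ t × b ≤ t
    common {a} {b} z La Lb with ≤-total a b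
    ... | inj₁ a≤b = b , Lb , a≤b , ≤-refl
    ... | inj₂ b≤a = a , La , ≤-refl , b≤a

    <-meet : ∀ {p c d} → p < c → p < d → ∃ λ e → p < e × e ≤ c × e ≤ d
    <-meet {p} {c} {d} p<c p<d with ≤-total c d
    ... | inj₁ c≤d = c , p<c , ≤-refl , c≤d
    ... | inj₂ d≤c = d , p<d , d≤c , ≤-refl

    >-join : ∀ {p c d} → c < p → d < p → ∃ λ e → e < p × c ≤ e × d ≤ e
    >-join {p} {c} {d} c<p d<p with ≤-total c d
    ... | inj₁ c≤d = d , d<p , c≤d , ≤-refl
    ... | inj₂ d≤c = c , c<p , ≤-refl , d≤c

    room< : ∀ a a′ b b′ → AllBelow p a a′ b b′ → ∃ λ q → p < q × AllBelow q a a′ b b′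
    room< _ _ _ _ (c₁ , c₂ , c₃ , c₄) =
      let e , p<e , e₁ , e₂ = <-meet c₁ c₂
          f , p<f , f₁ , f₂ = <-meet c₃ c₄
          g , p<g , g₁ , g₂ = <-meet p<e p<f
          q , p<q , q<g     = <-dense p<g
      in q , p<q , <-≤-trans q<g (≤-trans g₁ e₁) , <-≤-trans q<g (≤-trans g₁ e₂)
                 , <-≤-trans q<g (≤-trans g₂ f₁) , <-≤-trans q<g (≤-trans g₂ f₂)

    room> : ∀ a a′ b b′ → AllAbove q a a′ b b′ → ∃ λ p → p < q × AllAbove p a a′ b b′
    room> _ _ _ _ (c₁ , c₂ , c₃ , c₄) =
      let e , e<q , e₁ , e₂ = >-join c₁ c₂
          f , f<q , f₁ , f₂ = >-join c₃ c₄
          g , g<q , g₁ , g₂ = >-join e<q f<q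
          p , g<p , p<q     = <-dense g<q
      in p , p<q , ≤-<-trans (≤-trans e₁ g₁) g<p , ≤-<-trans (≤-trans e₂ g₁) g<p
                 , ≤-<-trans (≤-trans f₁ g₂) g<p , ≤-<-trans (≤-trans f₂ g₂) g<p

    Box : ℚ → Set
    Box ε = ∃₂ λ a a′ → ∃₂ λ b b′ → (L x a × U x a′) × (L y b × U y b′) × ∃ λ η → η + η < ε × Within a a′ b b′ η

    box : 0ℚ < p → Box p
    box {p} 0<p =
      let B , 0≤B , boundA  = approximantsBounded x
          C , 0≤C , boundB  = approximantsBounded y
      in build 0≤B 0≤C boundA boundB (smallFactor (+-mono-< (0<K 0≤B 0≤C) (0<K 0≤B 0≤C)) 0<p)
      where
      0<K : ∀ {B C} → 0ℚ ≤ B → 0ℚ ≤ C → 0ℚ < B + C + 1ℚ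
      0<K 0≤B 0≤C = +-mono-≤-< (+-mono-≤ 0≤B 0≤C) (positive⁻¹ 1ℚ)
      build : ∀ {B C} → 0ℚ ≤ B → 0ℚ ≤ C →
              (∀ {a δ} → δ ≤ 1ℚ → L x a → U x (a + δ) → - B ≤ a × a ≤ B) →
              (∀ {b δ} → δ ≤ 1ℚ → L y b → U y (b + δ) → - C ≤ b × b ≤ C) →
              (∃ λ δ → 0ℚ < δ × δ ≤ 1ℚ × (B + C + 1ℚ + (B + C + 1ℚ)) * δ < p) → Box p
      build {B} {C} 0≤B 0≤C boundA boundB (δ , 0<δ , δ≤1 , Kδ<p) =
        let a , La , Ua = approximate x 0<δ
            b , Lb , Ub = approximate y 0<δ
        in a , a + δ , b , b + δ , (La , Ua) , (Lb , Ub)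
         , (B + C + 1ℚ) * δ
         , subst (_< p) (*-distribʳ-+ δ (B + C + 1ℚ) (B + C + 1ℚ)) Kδ<p
         , corners 0<δ δ≤1 0≤B 0≤C (boundA δ≤1 La Ua) (boundB δ≤1 Lb Ub)

    inh : ∃ Lo × ∃ Up
    inh = go (box (positive⁻¹ 1ℚ)) where
      go : Box 1ℚ → ∃ Lo × ∃ Up
      go (a , a′ , b , b′ , as , bs , η , _ , w) =
          (_ , a , a′ , b , b′ , as , bs , below-corners {a} {a′} {b} {b′} {η = η} w (q-1<q (a * b - η)))
        , (_ , a , a′ , b , b′ , as , bs , above-corners {a} {a′} {b} {b′} {η = η} w (q<q+1 (a * b + η)))

    loc : p < q → Lo p ⊎ Up q
    loc {p} {q} p<q = go (box (below p<q)) where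
      upper : ∀ c d → c - d ≤ p → d + d < q - p → c + d < q
      upper c d c-d≤p 2d<q-p = subst₂ _<_
        (solve 2 (λ c d → c :- d :+ (d :+ d) := c :+ d) refl c d)
        (solve 2 (λ p q → p :+ (q :- p) := q) refl p q)
        (+-mono-≤-< c-d≤p 2d<q-p)
      go : Box (q - p) → Lo p ⊎ Up q
      go (a , a′ , b , b′ , as , bs , η , 2η<q-p , w) = decide
        (λ lo → a , a′ , b , b′ , as , bs , below-corners {a} {a′} {b} {b′} {η = η} w lo)
        (λ le → a , a′ , b , b′ , as , bs , above-corners {a} {a′} {b} {b′} {η = η} w (upper (a * b) η le 2η<q-p))

  infix 30 _⁺ _⁻

  _⁺ _⁻ : ℤ → ℕ
  (ℤ.+ n)    ⁺ = n
  ℤ.-[1+ n ] ⁺ = 0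
  (ℤ.+ n)    ⁻ = 0
  ℤ.-[1+ n ] ⁻ = suc n

  num⁺ num⁻ : ℚ → ℕ
  num⁺ e = (↥ e) ⁺
  num⁻ e = (↥ e) ⁻

  -- s ≤ M ^ (a / d) means s ^ d ≤ M ^ a; the negative part of a is moved to the side of s.
  _≤[_^_] [_^_]≤_ : ℚ → ℚ → ℚ → Set
  s ≤[ M ^ e ] = M ^ num⁻ e * s ^ ↧ₙ e ≤ M ^ num⁺ e
  [ M ^ e ]≤ s = M ^ num⁺ e ≤ M ^ num⁻ e * s ^ ↧ₙ e

  ↥≡⁺-⁻ : ∀ e → fromℤ (↥ e) ≡ ι (num⁺ e) - ι (num⁻ e)
  ↥≡⁺-⁻ e = go (↥ e) where
    go : ∀ i → fromℤ i ≡ ι (i ⁺) - ι (i ⁻)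
    go (ℤ.+ n)    = sym (+-identityʳ (ι n))
    go ℤ.-[1+ n ] = sym (+-identityˡ (fromℤ ℤ.-[1+ n ]))

  exponent : ∀ e → e * ι (↧ₙ e) ≡ ι (num⁺ e) - ι (num⁻ e)
  exponent e = trans (numeratorIdentity e) (↥≡⁺-⁻ e)

  module _ {e e′ I J D I′ J′ D′ : ℚ} (0≤D : 0ℚ ≤ D) (0≤D′ : 0ℚ ≤ D′)
           (eq : e * D ≡ I - J) (eq′ : e′ * D′ ≡ I′ - J′) where

    crossGap : ∀ {K c} → 0ℚ ≤ K → K * e′ ≤ K * e + c →
               K * (I′ * D) + K * (J * D′) ≤ K * (I * D′) + K * (J′ * D) + c * (D * D′)
    crossGap {K} {c} 0≤K gap = subst₂ _≤_
      (trans (cong (λ z → K * (z * D) + (K * (J′ * D) + K * (J * D′))) eq′)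
             (solve 6 (λ K I J D J₂ D₂ → K :* ((I :- J) :* D) :+ (K :* (J :* D) :+ K :* (J₂ :* D₂))
                                          := K :* (I :* D) :+ K :* (J₂ :* D₂)) refl K I′ J′ D J D′))
      (trans (cong (λ z → K * (z * D′) + c * (D * D′) + (K * (J′ * D) + K * (J * D′))) eq)
             (solve 7 (λ K c I J D J₂ D₂ → K :* ((I :- J) :* D₂) :+ c :* (D :* D₂) :+ (K :* (J₂ :* D) :+ K :* (J :* D₂))
                                          := K :* (I :* D₂) :+ K :* (J₂ :* D) :+ c :* (D :* D₂)) refl K c I J D J′ D′))
      (+-monoˡ-≤ (K * (J′ * D) + K * (J * D′)) (subst₂ _≤_
        (solve 4 (λ K e D D′ → K :* e :* (D :* D′) := K :* (e :* D′ :* D)) refl K e′ D D′)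
        (solve 5 (λ K e c D D′ → (K :* e :+ c) :* (D :* D′) := K :* (e :* D :* D′) :+ c :* (D :* D′)) refl K e c D D′)
        (*-monoʳ-≤-nonNeg (D * D′) {{nonNegative (0≤* 0≤D 0≤D′)}} gap)))

  ℕ-crossGap : ∀ K c e e′ → ι K * e′ ≤ ι K * e + ι c →
               K ℕ.* (num⁺ e′ ℕ.* ↧ₙ e) ℕ.+ K ℕ.* (num⁻ e ℕ.* ↧ₙ e′)
                 ℕ.≤ K ℕ.* (num⁺ e ℕ.* ↧ₙ e′) ℕ.+ K ℕ.* (num⁻ e′ ℕ.* ↧ₙ e) ℕ.+ c ℕ.* (↧ₙ e ℕ.* ↧ₙ e′)
  ℕ-crossGap K c e e′ gap = ι-cancel (subst₂ _≤_
    (sym (trans (ι-+ (K ℕ.* (num⁺ e′ ℕ.* ↧ₙ e)) _) (cong₂ _+_ (ι-** K (num⁺ e′) (↧ₙ e)) (ι-** K (num⁻ e) (↧ₙ e′)))))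
    (sym (trans (ι-+ (K ℕ.* (num⁺ e ℕ.* ↧ₙ e′) ℕ.+ K ℕ.* (num⁻ e′ ℕ.* ↧ₙ e)) _) (cong₂ _+_
      (trans (ι-+ (K ℕ.* (num⁺ e ℕ.* ↧ₙ e′)) _) (cong₂ _+_ (ι-** K (num⁺ e) (↧ₙ e′)) (ι-** K (num⁻ e′) (↧ₙ e))))
      (ι-** c (↧ₙ e) (↧ₙ e′)))))
    (crossGap {e} {e′} {ι (num⁺ e)} {ι (num⁻ e)} {ι (↧ₙ e)} {ι (num⁺ e′)} {ι (num⁻ e′)} {ι (↧ₙ e′)} (0≤ι (↧ₙ e)) (0≤ι (↧ₙ e′)) (exponent e) (exponent e′) {ι K} {ι c} (0≤ι K) gap))
    where
    ι-** : ∀ a b c → ι (a ℕ.* (b ℕ.* c)) ≡ ι a * (ι b * ι c)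
    ι-** a b c = trans (ι-* a (b ℕ.* c)) (cong (λ z → ι a * z) (ι-* b c))

  ^-cancel-≤ : ∀ {s t} n → 0ℚ ≤ t → s ^ suc n ≤ t ^ suc n → s ≤ t
  ^-cancel-≤ {s} {t} n 0≤t le with s ≤? t
  ... | yes s≤t = s≤t
  ... | no  s≰t = ⊥-elim (<-irrefl refl (<-≤-trans (^-mono-< n 0≤t (≰⇒> s≰t)) le))

  raise : ∀ M s J D n → (M ^ J * s ^ D) ^ n ≡ M ^ (J ℕ.* n) * s ^ (D ℕ.* n)
  raise M s J D n = trans (^-distrib-* (M ^ J) (s ^ D) n) (cong₂ _*_ (^-assocʳ M J n) (^-assocʳ s D n))

  module _ {M : ℚ} (1≤M : 1ℚ ≤ M) where

    private
      0<M : 0ℚ < M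
      0<M = <-≤-trans (positive⁻¹ 1ℚ) 1≤M
      0≤M : ∀ n → 0ℚ ≤ M ^ n
      0≤M n = 0≤^ n (<⇒≤ 0<M)

    -- The two bounds are compared after clearing the denominators of the exponents.
    lowerBelowUpper : ∀ {s t} I J D-1 I′ J′ D′-1 (let D = suc D-1; D′ = suc D′-1) → 0ℚ ≤ s → 0ℚ ≤ t →
      M ^ J * s ^ D ≤ M ^ I → M ^ I′ ≤ M ^ J′ * t ^ D′ →
      I ℕ.* D′ ℕ.+ J′ ℕ.* D ℕ.≤ I′ ℕ.* D ℕ.+ J ℕ.* D′ → s ≤ t
    lowerBelowUpper {s} {t} I J D-1 I′ J′ D′-1 0≤s 0≤t lo hi le = ^-cancel-≤ (D′-1 ℕ.+ D-1 ℕ.* suc D′-1) 0≤t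
      (*-cancelˡ-≤-pos (M ^ (J′ ℕ.* D ℕ.+ J ℕ.* D′)) {{positive (0<^ (J′ ℕ.* D ℕ.+ J ℕ.* D′) 0<M)}} chain)
      where
      D = suc D-1; D′ = suc D′-1
      lo′ : M ^ (J ℕ.* D′) * s ^ (D ℕ.* D′) ≤ M ^ (I ℕ.* D′)
      lo′ = subst₂ _≤_ (raise M s J D D′) (^-assocʳ M I D′) (^-mono D′ (0≤* (0≤M J) (0≤^ D 0≤s)) lo)
      hi′ : M ^ (I′ ℕ.* D) ≤ M ^ (J′ ℕ.* D) * t ^ (D ℕ.* D′)
      hi′ = subst₂ _≤_ (^-assocʳ M I′ D) (trans (raise M t J′ D′ D) (cong (λ n → M ^ (J′ ℕ.* D) * t ^ n) (ℕₚ.*-comm D′ D)))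
              (^-mono D (0≤M I′) hi)
      split+ : ∀ m n z → M ^ (m ℕ.+ n) * z ≡ M ^ m * (M ^ n * z)
      split+ m n z = trans (cong (λ w → w * z) (^-homo-* M m n)) (*-assoc (M ^ m) (M ^ n) z)
      open ≤-Reasoning
      chain : M ^ (J′ ℕ.* D ℕ.+ J ℕ.* D′) * s ^ (D ℕ.* D′) ≤ M ^ (J′ ℕ.* D ℕ.+ J ℕ.* D′) * t ^ (D ℕ.* D′)
      chain = begin
        M ^ (J′ ℕ.* D ℕ.+ J ℕ.* D′) * s ^ (D ℕ.* D′)          ≡⟨ split+ (J′ ℕ.* D) (J ℕ.* D′) _ ⟩
        M ^ (J′ ℕ.* D) * (M ^ (J ℕ.* D′) * s ^ (D ℕ.* D′))    ≤⟨ *-monoˡ-≤-nonNeg (M ^ (J′ ℕ.* D)) {{nonNegative (0≤M (J′ ℕ.* D))}} lo′ ⟩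
        M ^ (J′ ℕ.* D) * M ^ (I ℕ.* D′)                       ≡⟨ *-comm (M ^ (J′ ℕ.* D)) _ ⟩
        M ^ (I ℕ.* D′) * M ^ (J′ ℕ.* D)                       ≡⟨ sym (^-homo-* M (I ℕ.* D′) (J′ ℕ.* D)) ⟩
        M ^ (I ℕ.* D′ ℕ.+ J′ ℕ.* D)                           ≤⟨ ^-mono-exp 1≤M le ⟩
        M ^ (I′ ℕ.* D ℕ.+ J ℕ.* D′)                           ≡⟨ ^-homo-* M (I′ ℕ.* D) (J ℕ.* D′) ⟩
        M ^ (I′ ℕ.* D) * M ^ (J ℕ.* D′)                       ≤⟨ *-monoʳ-≤-nonNeg (M ^ (J ℕ.* D′)) {{nonNegative (0≤M (J ℕ.* D′))}} hi′ ⟩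
        M ^ (J′ ℕ.* D) * t ^ (D ℕ.* D′) * M ^ (J ℕ.* D′)      ≡⟨ solve 3 (λ a b c → a :* b :* c := a :* (c :* b)) refl (M ^ (J′ ℕ.* D)) (t ^ (D ℕ.* D′)) (M ^ (J ℕ.* D′)) ⟩
        M ^ (J′ ℕ.* D) * (M ^ (J ℕ.* D′) * t ^ (D ℕ.* D′))    ≡⟨ sym (split+ (J′ ℕ.* D) (J ℕ.* D′) _) ⟩
        M ^ (J′ ℕ.* D ℕ.+ J ℕ.* D′) * t ^ (D ℕ.* D′)          ∎

    upperFromLower : ∀ {p q} K-1 I J D-1 I′ J′ D′ (let D = suc D-1; K = suc K-1) → 0ℚ ≤ p → 0ℚ ≤ q →
      M ^ I ≤ M ^ J * p ^ D → M * p ^ K ≤ q ^ K →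
      K ℕ.* (I′ ℕ.* D) ℕ.+ K ℕ.* (J ℕ.* D′) ℕ.≤ K ℕ.* (I ℕ.* D′) ℕ.+ K ℕ.* (J′ ℕ.* D) ℕ.+ 1 ℕ.* (D ℕ.* D′) →
      M ^ I′ ≤ M ^ J′ * q ^ D′
    upperFromLower {p} {q} K-1 I J D-1 I′ J′ D′ 0≤p 0≤q lo ratio le = ^-cancel-≤ (D-1 ℕ.+ K-1 ℕ.* suc D-1)
      (0≤* (0≤M J′) (0≤^ D′ 0≤q))
      (*-cancelˡ-≤-pos (M ^ X) {{positive (0<^ X 0<M)}} chain)
      where
      D = suc D-1; K = suc K-1; n = K ℕ.* D
      X = K ℕ.* (J ℕ.* D′); Y = K ℕ.* (J′ ℕ.* D); Z = D ℕ.* D′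
      module S = ℕS.+-*-Solver
      perm : ∀ K J D → J ℕ.* (K ℕ.* D) ≡ K ℕ.* (J ℕ.* D)
      perm = S.solve 3 (λ K J D → J S.:* (K S.:* D) S.:= K S.:* (J S.:* D)) refl
      lo′ : M ^ (K ℕ.* (I ℕ.* D′)) ≤ M ^ X * p ^ (K ℕ.* Z)
      lo′ = subst₂ _≤_ (trans (^-assocʳ M I (K ℕ.* D′)) (cong (M ^_) (perm K I D′)))
              (trans (raise M p J D (K ℕ.* D′)) (cong₂ (λ a b → M ^ a * p ^ b) (perm K J D′) (perm K D D′)))
              (^-mono (K ℕ.* D′) (0≤M I) lo)
      ratio′ : M ^ Z * p ^ (K ℕ.* Z) ≤ q ^ (K ℕ.* Z)
      ratio′ = subst₂ _≤_ (trans (^-distrib-* M (p ^ K) Z) (cong (λ z → M ^ Z * z) (^-assocʳ p K Z))) (^-assocʳ q K Z)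
                 (^-mono Z (0≤* (<⇒≤ 0<M) (0≤^ K 0≤p)) ratio)
      open ≤-Reasoning
      chain : M ^ X * (M ^ I′) ^ n ≤ M ^ X * (M ^ J′ * q ^ D′) ^ n
      chain = begin
        M ^ X * (M ^ I′) ^ n                                  ≡⟨ cong (λ z → M ^ X * z) (trans (^-assocʳ M I′ n) (cong (M ^_) (perm K I′ D))) ⟩
        M ^ X * M ^ (K ℕ.* (I′ ℕ.* D))                        ≡⟨ *-comm (M ^ X) _ ⟩
        M ^ (K ℕ.* (I′ ℕ.* D)) * M ^ X                        ≡⟨ sym (^-homo-* M (K ℕ.* (I′ ℕ.* D)) X) ⟩
        M ^ (K ℕ.* (I′ ℕ.* D) ℕ.+ X)                          ≤⟨ ^-mono-exp 1≤M le ⟩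
        M ^ (K ℕ.* (I ℕ.* D′) ℕ.+ Y ℕ.+ 1 ℕ.* Z)              ≡⟨ cong (λ z → M ^ (K ℕ.* (I ℕ.* D′) ℕ.+ Y ℕ.+ z)) (ℕₚ.*-identityˡ Z) ⟩
        M ^ (K ℕ.* (I ℕ.* D′) ℕ.+ Y ℕ.+ Z)                    ≡⟨ trans (^-homo-* M (K ℕ.* (I ℕ.* D′) ℕ.+ Y) Z) (cong (λ z → z * M ^ Z) (^-homo-* M (K ℕ.* (I ℕ.* D′)) Y)) ⟩
        M ^ (K ℕ.* (I ℕ.* D′)) * M ^ Y * M ^ Z                ≤⟨ *-monoʳ-≤-nonNeg (M ^ Z) {{nonNegative (0≤M Z)}} (*-monoʳ-≤-nonNeg (M ^ Y) {{nonNegative (0≤M Y)}} lo′) ⟩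
        M ^ X * p ^ (K ℕ.* Z) * M ^ Y * M ^ Z                 ≡⟨ solve 4 (λ x p y z → x :* p :* y :* z := x :* (y :* (z :* p))) refl (M ^ X) (p ^ (K ℕ.* Z)) (M ^ Y) (M ^ Z) ⟩
        M ^ X * (M ^ Y * (M ^ Z * p ^ (K ℕ.* Z)))             ≤⟨ *-monoˡ-≤-nonNeg (M ^ X) {{nonNegative (0≤M X)}} (*-monoˡ-≤-nonNeg (M ^ Y) {{nonNegative (0≤M Y)}} ratio′) ⟩
        M ^ X * (M ^ Y * q ^ (K ℕ.* Z))                       ≡⟨ cong (λ z → M ^ X * z) (sym (trans (raise M q J′ D′ n) (cong₂ (λ a b → M ^ a * q ^ b) (perm K J′ D) (trans (perm K D′ D) (cong (K ℕ.*_) (ℕₚ.*-comm D′ D)))))) ⟩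
        M ^ X * (M ^ J′ * q ^ D′) ^ n                         ∎

  bernoulli : ∀ {p d} → 0ℚ < p → 0ℚ < d → ∀ K → p ^ K * (p + multiple K d) ≤ (p + d) ^ K * p
  bernoulli {p} {d} 0<p 0<d zero    = ≤-reflexive (cong (λ z → 1ℚ * z) (+-identityʳ p))
  bernoulli {p} {d} 0<p 0<d (suc K) = begin
    p * P * (p + (d + S))                   ≤⟨ p≤p+q {p * P * (p + (d + S))} (0≤* (0≤^ K (<⇒≤ 0<p)) (0≤* (<⇒≤ 0<d) (0≤multiple K))) ⟩
    p * P * (p + (d + S)) + P * (d * S)     ≡⟨ solve 4 (λ p P d S → p :* P :* (p :+ (d :+ S)) :+ P :* (d :* S) := (p :+ d) :* (P :* (p :+ S))) refl p P d S ⟩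
    (p + d) * (P * (p + S))                 ≤⟨ *-monoˡ-≤-nonNeg (p + d) {{nonNegative (<⇒≤ (+-mono-< 0<p 0<d))}} (bernoulli 0<p 0<d K) ⟩
    (p + d) * ((p + d) ^ K * p)             ≡⟨ sym (*-assoc (p + d) ((p + d) ^ K) p) ⟩
    (p + d) * (p + d) ^ K * p               ∎
    where
    open ≤-Reasoning
    P = p ^ K
    S = multiple K d
    0≤multiple : ∀ K → 0ℚ ≤ multiple K d
    0≤multiple zero    = ≤-refl
    0≤multiple (suc K) = +-mono-≤ (<⇒≤ 0<d) (0≤multiple K)
    p≤p+q : ∀ {a b} → 0ℚ ≤ b → a ≤ a + b
    p≤p+q {a} {b} 0≤b = subst (_≤ a + b) (+-identityʳ a) (+-monoʳ-≤ a 0≤b)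

  ratio : ∀ {p q} M → 0ℚ < p → p < q → ∃ λ K-1 → M * p ^ suc K-1 ≤ q ^ suc K-1
  ratio {p} {q} M 0<p p<q =
    let N , Mp<N*gap = archimedean* (M * p) 0<gap
    in N , *-cancelʳ-≤-pos p {{positive 0<p}} (begin
      M * p ^ suc N * p                        ≡⟨ solve 3 (λ m x p → m :* x :* p := x :* (m :* p)) refl M (p ^ suc N) p ⟩
      p ^ suc N * (M * p)                      ≤⟨ *-monoˡ-≤-nonNeg (p ^ suc N) {{nonNegative (0≤^ (suc N) (<⇒≤ 0<p))}}
                                                    (≤-trans (<⇒≤ Mp<N*gap) (≤-trans (≤-reflexive (sym (multiple≡ N gap))) (more (multiple N gap)))) ⟩
      p ^ suc N * (p + multiple (suc N) gap)     ≤⟨ bernoulli 0<p 0<gap (suc N) ⟩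
      (p + gap) ^ suc N * p                      ≡⟨ cong (λ z → z ^ suc N * p) (solve 2 (λ p q → p :+ (q :- p) := q) refl p q) ⟩
      q ^ suc N * p                            ∎)
    where
    open ≤-Reasoning
    gap = q - p
    0<gap : 0ℚ < gap
    0<gap = below p<q
    more : ∀ m → m ≤ p + (gap + m)
    more m = subst₂ _≤_ (trans (+-identityˡ _) (+-identityˡ m)) refl
               (+-mono-≤ (<⇒≤ 0<p) (+-monoˡ-≤ m (<⇒≤ 0<gap)))

  1/suc : ∀ k → ∃ λ δ → 0ℚ < δ × ι (suc k) * δ ≡ 1ℚ
  1/suc k = 1/ (ι (suc k)) , positive⁻¹ _ {{1/pos⇒pos (ι (suc k))}} , *-inverseʳ (ι (suc k))

  -- For M ≥ 1 the power M ^ e is monotone in e, so M ^ x is cut out by the rational powers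
  -- M ^ e with e < x and those with e > x.
  power : (M : ℚ) → 1ℚ ≤ M → ℝ → ℝ
  power M 1≤M x = record
    { L         = Lo
    ; U         = Up
    ; inhabited = let (l , Ll) , (u , Uu) = inhabited x
                  in (- 1ℚ , l , 0ℚ , Ll , ≤-refl , negative⁻¹ (- 1ℚ) , 0≤pow l)
                   , (_ , u , M ^ num⁺ u , Uu , 0≤M (num⁺ u) , q<q+1 (M ^ num⁺ u) , pow≤ u)
    ; L-down    = λ p<q (e , s , Le , 0≤s , q<s , s≤) → e , s , Le , 0≤s , <-trans p<q q<s , s≤
    ; L-open    = λ (e , s , Le , 0≤s , p<s , s≤) → let q , p<q , q<s = <-dense p<s in q , p<q , e , s , Le , 0≤s , q<s , s≤
    ; U-up      = λ p<q (e , s , Ue , 0≤s , s<p , ≤s) → e , s , Ue , 0≤s , <-trans s<p p<q , ≤s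
    ; U-open    = λ (e , s , Ue , 0≤s , s<q , ≤s) → let p , s<p , p<q = <-dense s<q in p , p<q , e , s , Ue , 0≤s , s<p , ≤s
    ; disjoint  = λ (e , s , Le , 0≤s , q<s , s≤) (e′ , t , Ue′ , 0≤t , t<q , ≤t) →
                    <-irrefl refl (<-≤-trans (<-trans t<q q<s) (compare e e′ 0≤s 0≤t (L<U x Le Ue′) s≤ ≤t))
    ; located   = loc
    }
    where
    Lo Up : ℚ → Set
    Lo q = ∃₂ λ e s → L x e × 0ℚ ≤ s × q < s × s ≤[ M ^ e ]
    Up q = ∃₂ λ e s → U x e × 0ℚ ≤ s × s < q × [ M ^ e ]≤ s

    0≤M : ∀ n → 0ℚ ≤ M ^ n
    0≤M n = 0≤^ n (≤-trans (nonNegative⁻¹ 1ℚ) 1≤M)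

    1≤M^ : ∀ n → 1ℚ ≤ M ^ n
    1≤M^ n = ^-mono-exp {m = 0} {n} 1≤M ℕ.z≤n

    0≤pow : ∀ e → 0ℚ ≤[ M ^ e ]
    0≤pow e = subst (_≤ M ^ num⁺ e)
      (sym (trans (cong (λ z → M ^ num⁻ e * z) (*-zeroˡ (0ℚ ^ ℚ.denominator-1 e))) (*-zeroʳ (M ^ num⁻ e)))) (0≤M (num⁺ e))

    pow≤ : ∀ e → [ M ^ e ]≤ (M ^ num⁺ e)
    pow≤ e = ≤-trans (≤-trans (≤-reflexive (sym (*-identityʳ N))) (^-mono-exp {N} {1} {↧ₙ e} (1≤M^ (num⁺ e)) (ℕ.s≤s ℕ.z≤n)))
      (subst (_≤ M ^ num⁻ e * N ^ ↧ₙ e) (*-identityˡ (N ^ ↧ₙ e))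
        (*-monoʳ-≤-nonNeg (N ^ ↧ₙ e) {{nonNegative (0≤^ (↧ₙ e) (0≤M (num⁺ e)))}} (1≤M^ (num⁻ e))))
      where N = M ^ num⁺ e

    compare : ∀ e e′ → 0ℚ ≤ s → 0ℚ ≤ t → e < e′ → s ≤[ M ^ e ] → [ M ^ e′ ]≤ t → s ≤ t
    compare e e′ 0≤s 0≤t e<e′ s≤ ≤t =
      lowerBelowUpper 1≤M (num⁺ e) (num⁻ e) (ℚ.denominator-1 e) (num⁺ e′) (num⁻ e′) (ℚ.denominator-1 e′) 0≤s 0≤t s≤ ≤t
        (simplify (num⁺ e ℕ.* ↧ₙ e′) (num⁻ e′ ℕ.* ↧ₙ e) (num⁺ e′ ℕ.* ↧ₙ e) (num⁻ e ℕ.* ↧ₙ e′) (↧ₙ e′ ℕ.* ↧ₙ e)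
          (ℕ-crossGap 1 0 e′ e (subst₂ _≤_ (sym (*-identityˡ e)) (sym (trans (+-identityʳ _) (*-identityˡ e′))) (<⇒≤ e<e′))))
      where
      simplify : ∀ a b c d n → 1 ℕ.* a ℕ.+ 1 ℕ.* b ℕ.≤ 1 ℕ.* c ℕ.+ 1 ℕ.* d ℕ.+ 0 ℕ.* n → a ℕ.+ b ℕ.≤ c ℕ.+ d
      simplify a b c d n = subst₂ ℕ._≤_
        (cong₂ ℕ._+_ (ℕₚ.*-identityˡ a) (ℕₚ.*-identityˡ b))
        (trans (ℕₚ.+-identityʳ _) (cong₂ ℕ._+_ (ℕₚ.*-identityˡ c) (ℕₚ.*-identityˡ d)))

    nearby : ∀ a δ k → ι (suc k) * δ ≡ 1ℚ → ι (suc k) * (a + δ) ≤ ι (suc k) * a + ι 1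
    nearby a δ k Kδ≡1 = ≤-reflexive (trans (*-distribˡ-+ (ι (suc k)) a δ) (cong (λ z → ι (suc k) * a + z) Kδ≡1))

    locateAt : ∀ {a p′ q′} k → p < p′ → q′ < q → 0ℚ ≤ p′ → 0ℚ ≤ q′ → M * p′ ^ suc k ≤ q′ ^ suc k →
               (δ : ∃ λ δ → 0ℚ < δ × ι (suc k) * δ ≡ 1ℚ) → L x a → U x (a + proj₁ δ) → Lo p ⊎ Up q
    locateAt {a = a} {p′} {q′} k p<p′ q′<q 0≤p′ 0≤q′ ratio (δ , _ , Kδ≡1) La Ua
      with M ^ num⁻ a * p′ ^ ↧ₙ a ≤? M ^ num⁺ a
    ... | yes le = inj₁ (a , p′ , La , 0≤p′ , p<p′ , le)
    ... | no  ≰  = inj₂ (a + δ , q′ , Ua , 0≤q′ , q′<q ,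
      upperFromLower 1≤M k (num⁺ a) (num⁻ a) (ℚ.denominator-1 a) (num⁺ (a + δ)) (num⁻ (a + δ)) (↧ₙ (a + δ)) 0≤p′ 0≤q′
        (<⇒≤ (≰⇒> ≰)) ratio (ℕ-crossGap (suc k) 1 a (a + δ) (nearby a δ k Kδ≡1)))

    loc : p < q → Lo p ⊎ Up q
    loc {p} {q} p<q with 0ℚ ≤? p
    ... | no  0≰p = let l , Ll = proj₁ (inhabited x) in inj₁ (l , 0ℚ , Ll , ≤-refl , ≰⇒> 0≰p , 0≤pow l)
    ... | yes 0≤p =
      let p′ , p<p′ , p′<q  = <-dense p<q
          q′ , p′<q′ , q′<q = <-dense p′<q
          0<p′              = ≤-<-trans 0≤p p<p′
          k , Mp≤q          = ratio M 0<p′ p′<q′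
          δ                 = 1/suc k
          a , La , Ua       = approximate x (proj₁ (proj₂ δ))
      in locateAt k p<p′ q′<q (<⇒≤ 0<p′) (<⇒≤ (<-trans 0<p′ p′<q′)) Mp≤q δ La Ua

  infixr 8 _^ʳ_

  -- 0 ^ x is taken to be 0 for every x, which is its value whenever x > 0.
  _^ʳ_ : ℕ → ℝ → ℝ
  zero    ^ʳ x = fromℚ 0ℚ
  m@(suc k) ^ʳ x = power (ι m) (ι-mono {1} {m} (ℕ.s≤s ℕ.z≤n)) x

open Graphs public using (Graph; χ; C; h)
open Reals public using (ℝ; fromℕ; _≤ʳ_; _<ʳ_; _-ʳ_; _*ʳ_; _÷ʳ_; _⊓ʳ_; _^ʳ_)

module Submission where

-- Colour the vertices of G uniformly at random with k ≈ K m^(1−θ) colours.  An ℓ-cycle is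
-- monochromatic with probability k^(1−ℓ), and C_ℓ k^(1−ℓ) ≤ A_ℓ m K^(1−ℓ) since θ (ℓ−1) ≤ ε_ℓ.  So for
-- K large in terms of r and A some colouring has at most m/2 monochromatic cycles shorter than r.
-- Delete a vertex of each of them: the chromatic number stays at least m/2, and every colour class
-- now has girth at least r, so some class has chromatic number at least m/(2k) ≥ m^θ/(4K).
--
-- A rational below c m^θ is below c m^e for a rational e < θ, and only rational exponents
-- e = (I − J)/D are used, with both sides of an inequality raised to the power D.

open import Defs
open import Data.Product using (∃; _×_; _,_; map₂; proj₁; proj₂)
open import Relation.Binary.PropositionalEquality hiding (J)
open import Relation.Nullary using (¬_; Dec; yes; no; does; _×-dec_; ¬?)

-- Monochromatic short cycles and their deletion.

module Deletion where

  open Graphs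
  open import Data.Empty using (⊥-elim)
  open import Data.Fin using (Fin; zero; suc; toℕ; fromℕ<; combine)
  import Data.Fin.Properties as Finₚ
  open import Data.Fin.Subset using (Subset; _∈_; ∣_∣; inside; outside) renaming (_-_ to _∖_)
  open import Data.Fin.Subset.Properties using (_∈?_; x∈p∧x≢y⇒x∈p-y; x∈p⇒∣p-x∣<∣p∣)
  open import Data.List using (List; []; _∷_; _++_; map; length; allFin; concatMap; cartesianProductWith; filter)
  import Data.List.Properties as Listₚ
  open import Data.List.Membership.Propositional using (lose) renaming (_∈_ to _∈ᴸ_; find to findᴸ)
  import Data.List.Membership.Propositional.Properties as ∈ₚ
  import Data.List.Membership.Setoid.Properties as ∈ₛ
  open import Data.List.Membership.DecPropositional using () renaming (_∈?_ to ∈ᴸ-dec)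
  open import Data.List.Relation.Unary.All using (All; []; _∷_)
  open import Data.List.Relation.Unary.Any as Any using (here; there)
  open import Data.List.Relation.Unary.AllPairs using (_∷_)
  open import Data.List.Relation.Unary.Unique.Propositional using () renaming (Unique to Uniqueᴸ)
  import Data.List.Relation.Unary.Unique.Propositional.Properties as Uniqueₚ
  open import Data.Nat
  open import Data.Nat.ListAction using (sum)
  open import Data.Nat.ListAction.Properties using (sum-++)
  open import Data.Nat.Properties
  open import Data.Nat.Solver using (module +-*-Solver)
  open import Data.Vec as Vec using (Vec; []; _∷_; lookup; tabulate)
  import Data.Vec.Properties as Vecₚ
  import Data.Vec.Membership.Propositional as VecMem
  open import Data.Vec.Relation.Unary.All as Allᵛ using ()
  import Data.Vec.Relation.Unary.Any as Anyᵛ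
  open import Data.Vec.Relation.Unary.AllPairs using (_∷_)
  open import Data.Vec.Relation.Unary.Unique.Propositional using (Unique)
  open import Function using (_∘_; id; Equivalence)
  open import Relation.Nullary.Decidable using (dec-true)
  open import Relation.Unary using (Decidable)

  private variable
    A B X : Set
    n k ℓ : ℕ

  -- Finite sums and averages.

  ∑ : List A → (A → ℕ) → ℕ
  ∑ xs f = sum (map f xs)

  syntax ∑ xs (λ x → e) = ∑[ x ∈ xs ] e

  ∑-mono : ∀ (xs : List A) {f g : A → ℕ} → (∀ {x} → x ∈ᴸ xs → f x ≤ g x) → ∑ xs f ≤ ∑ xs g
  ∑-mono []       f≤g = ≤-refl
  ∑-mono (x ∷ xs) f≤g = +-mono-≤ (f≤g (here refl)) (∑-mono xs (f≤g ∘ there))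

  ∑-cong : ∀ (xs : List A) {f g : A → ℕ} → (∀ x → f x ≡ g x) → ∑ xs f ≡ ∑ xs g
  ∑-cong xs f≡g = cong sum (Listₚ.map-cong f≡g xs)

  ∑-const : ∀ (xs : List A) b → ∑[ _ ∈ xs ] b ≡ length xs * b
  ∑-const []       b = refl
  ∑-const (x ∷ xs) b = cong (b +_) (∑-const xs b)

  ∑-+ : ∀ (xs : List A) (f g : A → ℕ) → ∑[ x ∈ xs ] (f x + g x) ≡ ∑ xs f + ∑ xs g
  ∑-+ []       f g = refl
  ∑-+ (x ∷ xs) f g = trans (cong (f x + g x +_) (∑-+ xs f g))
    (solve 4 (λ a b c d → a :+ b :+ (c :+ d) := a :+ c :+ (b :+ d)) refl (f x) (g x) (∑ xs f) (∑ xs g))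
    where open +-*-Solver

  ∑-*ʳ : ∀ (xs : List A) (f : A → ℕ) b → ∑[ x ∈ xs ] (f x * b) ≡ ∑ xs f * b
  ∑-*ʳ []       f b = refl
  ∑-*ʳ (x ∷ xs) f b = trans (cong (f x * b +_) (∑-*ʳ xs f b)) (sym (*-distribʳ-+ b (f x) (∑ xs f)))

  ∑-swap : ∀ (xs : List A) (ys : List B) (f : A → B → ℕ) →
           ∑[ x ∈ xs ] ∑[ y ∈ ys ] f x y ≡ ∑[ y ∈ ys ] ∑[ x ∈ xs ] f x y
  ∑-swap []       ys f = sym (trans (∑-const ys 0) (*-zeroʳ (length ys)))
  ∑-swap (x ∷ xs) ys f = trans (cong (∑ ys (f x) +_) (∑-swap xs ys f)) (sym (∑-+ ys (f x) (λ y → ∑[ x ∈ xs ] f x y)))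

  ∑-++ : ∀ (xs ys : List A) (f : A → ℕ) → ∑ (xs ++ ys) f ≡ ∑ xs f + ∑ ys f
  ∑-++ xs ys f = trans (cong sum (Listₚ.map-++ f xs ys)) (sum-++ (map f xs) (map f ys))

  ∑-concatMap : ∀ (xs : List A) (g : A → List B) (f : B → ℕ) → ∑ (concatMap g xs) f ≡ ∑[ x ∈ xs ] ∑ (g x) f
  ∑-concatMap []       g f = refl
  ∑-concatMap (x ∷ xs) g f = trans (∑-++ (g x) (concatMap g xs) f) (cong (∑ (g x) f +_) (∑-concatMap xs g f))

  ∑-cartesianProductWith : ∀ (_⊗_ : A → B → X) xs ys (f : X → ℕ) →
                           ∑ (cartesianProductWith _⊗_ xs ys) f ≡ ∑[ x ∈ xs ] ∑[ y ∈ ys ] f (x ⊗ y)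
  ∑-cartesianProductWith _⊗_ []       ys f = refl
  ∑-cartesianProductWith _⊗_ (x ∷ xs) ys f = trans (∑-++ (map (x ⊗_) ys) (cartesianProductWith _⊗_ xs ys) f)
    (cong₂ _+_ (cong sum (sym (Listₚ.map-∘ ys))) (∑-cartesianProductWith _⊗_ xs ys f))

  -- Were every value at least `suc b`, the sum would reach `length xs * suc b`. Strictness also
  -- rules out the empty list.
  someBelowAverage : ∀ (xs : List A) {f : A → ℕ} {b} → ∑ xs f < length xs * suc b → ∃ λ x → f x ≤ b
  someBelowAverage (x ∷ xs) {f} {b} lt with f x ≤? b
  ... | yes fx≤b = x , fx≤b
  ... | no  fx≰b = someBelowAverage xs (+-cancelˡ-< (suc b) _ _ (≤-<-trans (+-monoˡ-≤ (∑ xs f) (≰⇒> fx≰b)) lt))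

  -- Counting the colourings that are constant on a set.

  module _ (_≟_ : (x y : A) → Dec (x ≡ y)) where

    δ : A → A → ℕ
    δ x y with x ≟ y
    ... | yes _ = 1
    ... | no  _ = 0

    δ-refl : ∀ x → δ x x ≡ 1
    δ-refl x with x ≟ x
    ... | yes _  = refl
    ... | no x≢x = ⊥-elim (x≢x refl)

    ∑-δ-∉ : ∀ xs {y} → All (y ≢_) xs → ∑[ x ∈ xs ] δ x y ≡ 0
    ∑-δ-∉ []       _            = refl
    ∑-δ-∉ (x ∷ xs) {y} (y≢x ∷ y∉xs) with x ≟ y
    ... | yes x≡y = ⊥-elim (y≢x (sym x≡y))
    ... | no  _   = ∑-δ-∉ xs y∉xs

    ∑-δ≤1 : ∀ {xs} → Uniqueᴸ xs → ∀ y → ∑[ x ∈ xs ] δ x y ≤ 1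
    ∑-δ≤1 {[]}     _             y = z≤n
    ∑-δ≤1 {x ∷ xs} (x∉xs ∷ xs!) y with x ≟ y
    ... | yes refl = ≤-reflexive (cong suc (∑-δ-∉ xs x∉xs))
    ... | no  _    = ∑-δ≤1 xs! y

  -- The 0/1 indicator that c takes the value j on all of S. Being a product over coordinates, its
  -- sum over all colourings factorises.
  constantly : Fin k → Subset n → Vec (Fin k) n → ℕ
  constantly j []            []      = 1
  constantly j (inside  ∷ S) (x ∷ c) = δ Finₚ._≟_ x j * constantly j S c
  constantly j (outside ∷ S) (x ∷ c) = constantly j S c

  -- For nonempty S this is the 0/1 indicator of a monochromatic set; for empty S it is k, one for
  -- each colour.
  monochromatic : Subset n → Vec (Fin k) n → ℕ
  monochromatic {k = k} S c = ∑[ j ∈ allFin k ] constantly j S c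

  constantly≡1 : ∀ (j : Fin k) (S : Subset n) c → (∀ {u} → u ∈ S → lookup c u ≡ j) → constantly j S c ≡ 1
  constantly≡1 j []            []      _   = refl
  constantly≡1 j (inside  ∷ S) (x ∷ c) c≡j with refl ← c≡j {zero} Vec.here =
    cong₂ _*_ (δ-refl Finₚ._≟_ x) (constantly≡1 x S c (c≡j ∘ Vec.there))
  constantly≡1 j (outside ∷ S) (x ∷ c) c≡j = constantly≡1 j S c (c≡j ∘ Vec.there)

  ∈⇒≤∑ : ∀ {xs : List A} {x} (f : A → ℕ) → x ∈ᴸ xs → f x ≤ ∑ xs f
  ∈⇒≤∑ f (here refl) = m≤m+n _ _
  ∈⇒≤∑ f (there x∈)  = ≤-trans (∈⇒≤∑ f x∈) (m≤n+m _ _)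

  0<monochromatic : ∀ (j : Fin k) (S : Subset n) c → (∀ {u} → u ∈ S → lookup c u ≡ j) → 0 < monochromatic S c
  0<monochromatic j S c c≡j = subst (_≤ monochromatic S c) (constantly≡1 j S c c≡j)
    (∈⇒≤∑ (λ j → constantly j S c) (∈ₚ.∈-allFin j))

  colourings : ∀ k n → List (Vec (Fin k) n)
  colourings k n = vectors (allFin k) n

  length-colourings : ∀ k n → length (colourings k n) ≡ k ^ n
  length-colourings k zero    = refl
  length-colourings k (suc n) = trans (go (allFin k))
    (cong₂ _*_ (Listₚ.length-tabulate {n = k} id) (length-colourings k n))
    where
    go : ∀ xs → length (cartesianProductWith Vec._∷_ xs (colourings k n)) ≡ length xs * length (colourings k n)
    go []       = refl
    go (x ∷ xs) = trans (Listₚ.length-++ (map (x Vec.∷_) (colourings k n)))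
      (cong₂ _+_ (Listₚ.length-map _ (colourings k n)) (go xs))

  -- A vertex of S leaves one choice of colour, any other vertex leaves k. The power of k stands on
  -- the left to avoid the exponent n - |S|.
  ∑-constantly : ∀ (j : Fin k) (S : Subset n) → ∑ (colourings k n) (constantly j S) * k ^ ∣ S ∣ ≤ k ^ n
  ∑-constantly {k} j []            = ≤-refl
  ∑-constantly {k} {suc n} j (inside ∷ S) = begin
    ∑ (colourings k (suc n)) (constantly j (inside ∷ S)) * (k * K)        ≡⟨ cong (_* (k * K)) (∑-cartesianProductWith Vec._∷_ (allFin k) cs _) ⟩
    ∑[ x ∈ allFin k ] ∑[ c ∈ cs ] (δ′ x * constantly j S c) * (k * K)     ≡⟨ cong (_* (k * K)) (trans (∑-cong (allFin k) factor) (∑-*ʳ (allFin k) δ′ W)) ⟩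
    ∑ (allFin k) δ′ * W * (k * K)                                         ≤⟨ *-monoˡ-≤ (k * K) (*-monoˡ-≤ W (∑-δ≤1 Finₚ._≟_ (Uniqueₚ.allFin⁺ k) j)) ⟩
    1 * W * (k * K)                                                       ≡⟨ solve 3 (λ W k K → con 1 :* W :* (k :* K) := k :* (W :* K)) refl W k K ⟩
    k * (W * K)                                                           ≤⟨ *-monoʳ-≤ k (∑-constantly j S) ⟩
    k ^ suc n                                                             ∎
    where
    open ≤-Reasoning
    open +-*-Solver
    cs = colourings k n
    K = k ^ ∣ S ∣
    W = ∑ cs (constantly j S)
    δ′ = λ x → δ Finₚ._≟_ x j
    factor : ∀ x → ∑[ c ∈ cs ] (δ′ x * constantly j S c) ≡ δ′ x * W
    factor x = trans (∑-cong cs λ c → *-comm (δ′ x) (constantly j S c))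
      (trans (∑-*ʳ cs (constantly j S) (δ′ x)) (*-comm W (δ′ x)))
  ∑-constantly {k} {suc n} j (outside ∷ S) = begin
    ∑ (colourings k (suc n)) (constantly j (outside ∷ S)) * K   ≡⟨ cong (_* K) (∑-cartesianProductWith Vec._∷_ (allFin k) cs _) ⟩
    ∑[ _ ∈ allFin k ] W * K                                     ≡⟨ cong (_* K) (trans (∑-const (allFin k) W) (cong (_* W) (Listₚ.length-tabulate {n = k} id))) ⟩
    k * W * K                                                   ≡⟨ *-assoc k W K ⟩
    k * (W * K)                                                 ≤⟨ *-monoʳ-≤ k (∑-constantly j S) ⟩
    k ^ suc n                                                   ∎
    where
    open ≤-Reasoning
    cs = colourings k n
    K = k ^ ∣ S ∣
    W = ∑ cs (constantly j S)

  -- Summing over the k possible common colours costs one factor k, so l of the at least l + 1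
  -- factors gained from S remain. This is the probability bound k^(-l), multiplied out.
  ∑-monochromatic : ∀ .{{_ : NonZero k}} (S : Subset n) {l} → suc l ≤ ∣ S ∣ → ∑ (colourings k n) (monochromatic S) * k ^ l ≤ k ^ n
  ∑-monochromatic {k} {n} S {l} l<S = *-cancelˡ-≤ k (begin
    k * (∑ cs (monochromatic S) * k ^ l)                          ≡⟨ solve 3 (λ k W K → k :* (W :* K) := W :* (k :* K)) refl k (∑ cs (monochromatic S)) (k ^ l) ⟩
    ∑ cs (monochromatic S) * k ^ suc l                            ≡⟨ cong (_* k ^ suc l) (∑-swap cs (allFin k) (λ c j → constantly j S c)) ⟩
    ∑[ j ∈ allFin k ] ∑ cs (constantly j S) * k ^ suc l           ≡⟨ sym (∑-*ʳ (allFin k) _ (k ^ suc l)) ⟩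
    ∑[ j ∈ allFin k ] (∑ cs (constantly j S) * k ^ suc l)         ≤⟨ ∑-mono (allFin k) (λ {j} _ → ≤-trans (*-monoʳ-≤ (∑ cs (constantly j S)) (^-monoʳ-≤ k l<S)) (∑-constantly j S)) ⟩
    ∑[ _ ∈ allFin k ] (k ^ n)                                     ≡⟨ trans (∑-const (allFin k) (k ^ n)) (cong (_* k ^ n) (Listₚ.length-tabulate {n = k} id)) ⟩
    k * k ^ n                                                     ∎)
    where
    open ≤-Reasoning
    open +-*-Solver
    cs = colourings k n

  -- Vertices of a cycle.

  unique⇒length≤ : ∀ {vs : Vec (Fin n) ℓ} (S : Subset n) → Unique vs → (∀ {u} → u VecMem.∈ vs → u ∈ S) → ℓ ≤ ∣ S ∣
  unique⇒length≤ {vs = []}     S _            _    = z≤n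
  unique⇒length≤ {vs = v ∷ vs} S (v∉vs ∷ vs!) vs⊆S = ≤-<-trans
    (unique⇒length≤ (S ∖ v) vs! (λ u∈ → x∈p∧x≢y⇒x∈p-y (vs⊆S (Anyᵛ.there u∈)) λ { refl → Allᵛ.lookup v∉vs u∈ refl }))
    (x∈p⇒∣p-x∣<∣p∣ (vs⊆S (Anyᵛ.here refl)))

  cycle-size : ∀ {K : Graph n} → IsCycle ℓ K → ℓ ≤ ∣ Graph.V K ∣
  cycle-size {K = K} (_ , vs , vs! , vertices , _) =
    unique⇒length≤ (Graph.V K) vs! (λ {u} u∈ → Equivalence.from (vertices u) u∈)

  cycle-vertex : ∀ {K : Graph n} → IsCycle ℓ K → ∃ λ v → v ∈ Graph.V K
  cycle-vertex (s≤s _ , v ∷ _ , _ , vertices , _) = v , Equivalence.from (vertices v) (Anyᵛ.here refl)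

  -- Induced subgraphs.

  subset : {P : Fin n → Set} → Decidable P → Subset n
  subset P? = tabulate (does ∘ P?)

  module _ {P : Fin n → Set} (P? : Decidable P) where

    ∈-subset⁺ : ∀ {v} → P v → v ∈ subset P?
    ∈-subset⁺ {v} Pv = Vecₚ.lookup⇒[]= v (subset P?) (trans (Vecₚ.lookup∘tabulate _ v) (dec-true (P? v) Pv))

    ∈-subset⁻ : ∀ {v} → v ∈ subset P? → P v
    ∈-subset⁻ {v} v∈ with P? v | trans (sym (Vecₚ.lookup∘tabulate (does ∘ P?) v)) (Vecₚ.[]=⇒lookup v∈)
    ... | yes Pv | _ = Pv
    ... | no  _  | ()

  module _ (G : Graph n) {P : Fin n → Set} (P? : Decidable P) where

    private
      vertex? : Decidable λ v → v ∈ Graph.V G × P v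
      vertex? v = (v ∈? Graph.V G) ×-dec P? v

      edge? : ∀ u → Decidable λ v → (u ~[ G ] v) × P u × P v
      edge? u v = (u ~?[ G ] v) ×-dec P? u ×-dec P? v

      rows : Vec (Subset n) n
      rows = tabulate λ u → subset (edge? u)

      row⁺ : ∀ u v → (u ~[ G ] v) × P u × P v → v ∈ lookup rows u
      row⁺ u v e = subst (v ∈_) (sym (Vecₚ.lookup∘tabulate _ u)) (∈-subset⁺ (edge? u) e)

      row⁻ : ∀ u v → v ∈ lookup rows u → (u ~[ G ] v) × P u × P v
      row⁻ u v v∈ = ∈-subset⁻ (edge? u) (subst (v ∈_) (Vecₚ.lookup∘tabulate _ u) v∈)

    induced : Graph n
    induced = mkGraph (subset vertex?) rows
      ( (λ u v uv → let e , Pu , Pv = row⁻ u v uv in row⁺ v u (proj₁ (simple G) u v e , Pv , Pu))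
      , (λ v vv → proj₁ (proj₂ (simple G)) v (proj₁ (row⁻ v v vv)))
      , (λ u v uv → let e , Pu , _ = row⁻ u v uv in ∈-subset⁺ vertex? (proj₂ (proj₂ (simple G)) u v e , Pu)))

    induced-⊑ : induced ⊑ G
    induced-⊑ = (λ v∈ → proj₁ (∈-subset⁻ vertex? v∈)) , λ u v uv → proj₁ (row⁻ u v uv)

    ∈-induced⁻ : ∀ {v} → v ∈ Graph.V induced → P v
    ∈-induced⁻ v∈ = proj₂ (∈-subset⁻ vertex? v∈)

    ∈-induced⁺ : ∀ {v} → v ∈ Graph.V G → P v → v ∈ Graph.V induced
    ∈-induced⁺ v∈ Pv = ∈-subset⁺ vertex? (v∈ , Pv)

    ~-induced⁺ : ∀ {u v} → u ~[ G ] v → P u → P v → u ~[ induced ] v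
    ~-induced⁺ {u} {v} e Pu Pv = row⁺ u v (e , Pu , Pv)

  -- Colour classes left after a deletion.

  module _ (G : Graph n) (ds : List (Fin n)) (c : Vec (Fin k) n) where

    private
      _∈ds? : Decidable (_∈ᴸ ds)
      _∈ds? = λ v → ∈ᴸ-dec Finₚ._≟_ v ds

      Remains : Fin k → Fin n → Set
      Remains j v = lookup c v ≡ j × ¬ v ∈ᴸ ds

      remains? : ∀ j → Decidable (Remains j)
      remains? j v = (lookup c v Finₚ.≟ j) ×-dec ¬? (v ∈ds?)

    part : Fin k → Graph n
    part j = induced G (remains? j)

    part-⊑ : ∀ j → part j ⊑ G
    part-⊑ j = induced-⊑ G (remains? j)

    ∈-part⁻ : ∀ {j v} → v ∈ Graph.V (part j) → lookup c v ≡ j × ¬ v ∈ᴸ ds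
    ∈-part⁻ {j} = ∈-induced⁻ G (remains? j)

    -- The deleted vertices get private colours, and the k parts get disjoint palettes of b further
    -- colours each.
    χ≤deleted+parts : ∀ b → (∀ j → χ (part j) ≤ b) → χ G ≤ length ds + k * b
    χ≤deleted+parts b χ≤b = χ-minimal (d + k * b) G (f , f< , proper)
      where
      d = length ds

      g : Fin k → Fin n → ℕ
      g j = proj₁ (χ-colourable (part j))

      -- Colours below d are positions in `ds`; a surviving vertex of part j uses the block of b
      -- colours that starts at d + b j.
      f : Fin n → ℕ
      f u with u ∈ds?
      ... | yes u∈ds = toℕ (Any.index u∈ds)
      ... | no  _    = d + (b * toℕ (lookup c u) + g (lookup c u) u)

      g< : ∀ {u} → u ∈ Graph.V G → ¬ u ∈ᴸ ds → g (lookup c u) u < b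
      g< {u} u∈V u∉ds = let j = lookup c u in
        <-≤-trans (proj₁ (proj₂ (χ-colourable (part j))) u (∈-induced⁺ G (remains? j) u∈V (refl , u∉ds))) (χ≤b j)

      -- Read through `combine`, the pair is below k * b and determines both the part and the colour
      -- inside it.
      pair≡ : ∀ {u} (lt : g (lookup c u) u < b) →
              b * toℕ (lookup c u) + g (lookup c u) u ≡ toℕ (combine (lookup c u) (fromℕ< lt))
      pair≡ {u} lt = sym (trans (Finₚ.toℕ-combine (lookup c u) (fromℕ< lt))
        (cong (b * toℕ (lookup c u) +_) (Finₚ.toℕ-fromℕ< lt)))

      f< : ∀ u → u ∈ Graph.V G → f u < d + k * b
      f< u u∈V with u ∈ds?
      ... | yes u∈ds = <-≤-trans (Finₚ.toℕ<n (Any.index u∈ds)) (m≤m+n d (k * b))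
      ... | no  u∉ds = +-monoʳ-< d (subst (_< k * b) (sym (pair≡ {u} (g< u∈V u∉ds))) (Finₚ.toℕ<n (combine (lookup c u) (fromℕ< (g< u∈V u∉ds)))))

      small≢large : ∀ {x} (i : Fin d) → toℕ i ≢ d + x
      small≢large i eq = <-irrefl eq (<-≤-trans (Finₚ.toℕ<n i) (m≤m+n d _))

      proper : ∀ u v → u ~[ G ] v → f u ≢ f v
      proper u v uv fu≡fv with u ∈ds? | v ∈ds?
      ... | yes u∈ | yes v∈ = proj₁ (proj₂ (simple G)) u
        (subst (u ~[ G ]_) (sym (∈ₛ.index-injective (setoid (Fin n)) u∈ v∈ (Finₚ.toℕ-injective fu≡fv))) uv)
      ... | yes u∈ | no  _  = small≢large (Any.index u∈) fu≡fv
      ... | no  _  | yes v∈ = small≢large (Any.index v∈) (sym fu≡fv)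
      -- Equal colours put u and v in the same part, where their edge survives and the colouring is
      -- proper.
      ... | no  u∉ | no  v∉ = proj₂ (proj₂ (χ-colourable (part (lookup c u)))) u v
          (~-induced⁺ G (remains? (lookup c u)) uv (refl , u∉) (sym cu≡cv , v∉))
          (trans gu≡gv (cong (λ j → g j v) (sym cu≡cv)))
        where
        u∈V = proj₂ (proj₂ (simple G)) u v uv
        v∈V = proj₂ (proj₂ (simple G)) v u (proj₁ (simple G) u v uv)
        lt  = g< u∈V u∉
        lt′ = g< v∈V v∉
        same : combine (lookup c u) (fromℕ< lt) ≡ combine (lookup c v) (fromℕ< lt′)
        same = Finₚ.toℕ-injective (trans (sym (pair≡ {u} lt)) (trans (+-cancelˡ-≡ d _ _ fu≡fv) (pair≡ {v} lt′)))
        cu≡cv : lookup c u ≡ lookup c v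
        cu≡cv = proj₁ (Finₚ.combine-injective (lookup c u) _ (lookup c v) _ same)
        gu≡gv : g (lookup c u) u ≡ g (lookup c v) v
        gu≡gv = Finₚ.fromℕ<-injective _ _ lt lt′ (proj₂ (Finₚ.combine-injective (lookup c u) _ (lookup c v) _ same))

  -- One vertex is taken from each graph of positive weight; that weight is at least 1 and pays for
  -- the vertex.
  hittingList : ∀ (Ks : List (Graph n)) (w : Graph n → ℕ) → (∀ {K} → K ∈ᴸ Ks → ∃ λ v → v ∈ Graph.V K) →
                ∃ λ ds → length ds ≤ ∑ Ks w × (∀ {K} → K ∈ᴸ Ks → 0 < w K → ∃ λ v → v ∈ᴸ ds × v ∈ Graph.V K)
  hittingList []       w _      = [] , z≤n , λ ()
  hittingList (K ∷ Ks) w vertex with hittingList Ks w (vertex ∘ there)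
  ... | ds , ds≤ , hit with w K in eq
  ... | zero   = ds , ds≤ , λ { (here refl) 0<w → ⊥-elim (n≮0 (subst (0 <_) eq 0<w)) ; (there K∈) → hit K∈ }
  ... | suc m  = let v , v∈K = vertex (here refl) in
    v ∷ ds , s≤s (≤-trans ds≤ (m≤n+m _ m)) , λ
      { (here refl) _ → v , here refl , v∈K
      ; (there K∈) 0<w → let u , u∈ds , u∈K = hit K∈ 0<w in u , there u∈ds , u∈K }

  -- Short cycles and the average over all colourings.

  cycles : ℕ → Graph n → List (Graph n)
  cycles {n} ℓ G = filter (λ K → (K ⊑? G) ×-dec isCycle? ℓ K) (graphs n)

  ∈-cycles⁻ : ∀ {G K : Graph n} → K ∈ᴸ cycles ℓ G → K ⊑ G × IsCycle ℓ K
  ∈-cycles⁻ {n} {ℓ} {G} K∈ = proj₂ (∈ₚ.∈-filter⁻ (λ K → (K ⊑? G) ×-dec isCycle? ℓ K) {xs = graphs n} K∈)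

  ∈-cycles⁺ : ∀ {G K : Graph n} → K ⊑ G → IsCycle ℓ K → K ∈ᴸ cycles ℓ G
  ∈-cycles⁺ {n} {ℓ} {G} {K} K⊑G cyc = ∈ₚ.∈-filter⁺ (λ K → (K ⊑? G) ×-dec isCycle? ℓ K) (∈-graphs K) (K⊑G , cyc)

  ⊑-trans : ∀ (F G H : Graph n) → F ⊑ G → G ⊑ H → F ⊑ H
  ⊑-trans _ _ _ (V⊆ , E⊆) (V⊆′ , E⊆′) = V⊆′ ∘ V⊆ , λ u v → E⊆′ u v ∘ E⊆ u v

  -- Linearity of expectation: a cycle has at least l + 1 vertices, so each one is monochromatic
  -- with probability at most k^(-l).
  ∑-monochromatic-cycles : ∀ (G : Graph n) {l} .{{_ : NonZero k}} →
    ∑[ c ∈ colourings k n ] ∑[ K ∈ cycles (suc l) G ] monochromatic (Graph.V K) c * k ^ l ≤ C (suc l) G * k ^ n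
  ∑-monochromatic-cycles {n} {k} G {l} = begin
    ∑[ c ∈ cs ] ∑[ K ∈ Ks ] monochromatic (Graph.V K) c * k ^ l   ≡⟨ cong (_* k ^ l) (∑-swap cs Ks (λ c K → monochromatic (Graph.V K) c)) ⟩
    ∑[ K ∈ Ks ] ∑ cs (monochromatic (Graph.V K)) * k ^ l          ≡⟨ sym (∑-*ʳ Ks (λ K → ∑ cs (monochromatic (Graph.V K))) (k ^ l)) ⟩
    ∑[ K ∈ Ks ] (∑ cs (monochromatic (Graph.V K)) * k ^ l)        ≤⟨ ∑-mono Ks (λ {K} K∈ → ∑-monochromatic {k} (Graph.V K) {l} (cycle-size {K = K} (proj₂ (∈-cycles⁻ {G = G} K∈)))) ⟩
    -- `Ks` is the filtered list in the definition of `C`, so its length is `C (suc l) G` by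
    -- computation.
    ∑[ _ ∈ Ks ] (k ^ n)                                           ≡⟨ ∑-const Ks (k ^ n) ⟩
    C (suc l) G * k ^ n                                           ∎
    where
    open ≤-Reasoning
    cs = colourings k n
    Ks = cycles (suc l) G

  -- The lengths 3 + i with i < t are exactly those from 3 to r - 1, where r = 3 + t.
  shortCycles : ℕ → Graph n → List (Graph n)
  shortCycles t G = concatMap (λ i → cycles (3 + toℕ i) G) (allFin t)

  -- Each of the t lengths contributes at most m/(2t) monochromatic cycles on average, hence at most
  -- m/2 together, and some colouring does no worse than the average.
  colouringWithFewMonochromaticCycles : ∀ (G : Graph n) t k m .{{_ : NonZero t}} .{{_ : NonZero k}} →
    (∀ (i : Fin t) → 2 * t * C (3 + toℕ i) G ≤ m * k ^ (2 + toℕ i)) →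
    ∃ λ (c : Vec (Fin k) n) → ∑[ K ∈ shortCycles t G ] monochromatic (Graph.V K) c * 2 ≤ m
  colouringWithFewMonochromaticCycles {n} G t k m few = someBelowAverage cs (begin-strict
    ∑[ c ∈ cs ] (total c * 2)   ≡⟨ ∑-*ʳ cs total 2 ⟩
    ∑ cs total * 2              ≤⟨ *-cancelˡ-≤ t averaged ⟩
    -- The strictness required by `someBelowAverage` comes from m < m + 1; it survives
    -- multiplication as k is positive.
    m * k ^ n                   <⟨ *-monoˡ-< (k ^ n) {{m^n≢0 k n}} (n<1+n m) ⟩
    suc m * k ^ n               ≡⟨ trans (*-comm (suc m) (k ^ n)) (cong (_* suc m) (sym (length-colourings k n))) ⟩
    length cs * suc m           ∎)
    where
    open ≤-Reasoning
    open +-*-Solver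
    cs = colourings k n
    total : Vec (Fin k) n → ℕ
    total c = ∑[ K ∈ shortCycles t G ] monochromatic (Graph.V K) c
    totalAt : Fin t → Vec (Fin k) n → ℕ
    totalAt i c = ∑[ K ∈ cycles (3 + toℕ i) G ] monochromatic (Graph.V K) c
    bound : ∀ i → ∑ cs (totalAt i) * (2 * t) ≤ m * k ^ n
    bound i = *-cancelʳ-≤ _ _ (k ^ (2 + toℕ i)) {{m^n≢0 k (2 + toℕ i)}} (begin
      S * (2 * t) * L                       ≡⟨ solve 3 (λ S t L → S :* t :* L := t :* (S :* L)) refl S (2 * t) L ⟩
      2 * t * (S * L)                       ≤⟨ *-monoʳ-≤ (2 * t) (∑-monochromatic-cycles {k = k} G {2 + toℕ i}) ⟩
      2 * t * (C (3 + toℕ i) G * k ^ n)     ≡⟨ sym (*-assoc (2 * t) (C (3 + toℕ i) G) (k ^ n)) ⟩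
      2 * t * C (3 + toℕ i) G * k ^ n       ≤⟨ *-monoˡ-≤ (k ^ n) (few i) ⟩
      m * L * k ^ n                         ≡⟨ solve 3 (λ m L N → m :* L :* N := m :* N :* L) refl m L (k ^ n) ⟩
      m * k ^ n * L                         ∎)
      where
      S = ∑ cs (totalAt i)
      L = k ^ (2 + toℕ i)
    averaged : t * (∑ cs total * 2) ≤ t * (m * k ^ n)
    averaged = begin
      t * (∑ cs total * 2)                          ≡⟨ solve 2 (λ t s → t :* (s :* con 2) := s :* (con 2 :* t)) refl t (∑ cs total) ⟩
      ∑ cs total * (2 * t)                          ≡⟨ cong (_* (2 * t)) (trans
                                                         (∑-cong cs λ c → ∑-concatMap (allFin t) (λ i → cycles (3 + toℕ i) G) (λ K → monochromatic (Graph.V K) c))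
                                                         (∑-swap cs (allFin t) (λ c i → totalAt i c))) ⟩
      ∑[ i ∈ allFin t ] ∑ cs (totalAt i) * (2 * t)  ≡⟨ sym (∑-*ʳ (allFin t) _ (2 * t)) ⟩
      ∑[ i ∈ allFin t ] (∑ cs (totalAt i) * (2 * t)) ≤⟨ ∑-mono (allFin t) (λ {i} _ → bound i) ⟩
      ∑[ _ ∈ allFin t ] (m * k ^ n)                 ≡⟨ trans (∑-const (allFin t) (m * k ^ n)) (cong (_* (m * k ^ n)) (Listₚ.length-tabulate {n = t} id)) ⟩
      t * (m * k ^ n)                               ∎

  -- With m = χ G and d deleted vertices, m ≤ d + k h and 2 d ≤ m. Doubling the first and cancelling
  -- one m gives the bound.
  χ≤2kh : ∀ (G : Graph n) t k .{{_ : NonZero t}} .{{_ : NonZero k}} →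
    (∀ (i : Fin t) → 2 * t * C (3 + toℕ i) G ≤ χ G * k ^ (2 + toℕ i)) → χ G ≤ 2 * (k * h (3 + t) G)
  χ≤2kh {n} G t k few = +-cancelˡ-≤ (χ G) _ _ (begin
    χ G + χ G                                ≡⟨ solve 1 (λ m → m :+ m := con 2 :* m) refl (χ G) ⟩
    2 * χ G                                  ≤⟨ *-monoʳ-≤ 2 (χ≤deleted+parts G ds c (h (3 + t) G) λ j → h-upper (3 + t) G (part G ds c j) (part-⊑ G ds c j) (girth j)) ⟩
    2 * (length ds + k * h (3 + t) G)        ≡⟨ solve 2 (λ d p → con 2 :* (d :+ p) := d :* con 2 :+ con 2 :* p) refl (length ds) (k * h (3 + t) G) ⟩
    length ds * 2 + 2 * (k * h (3 + t) G)    ≤⟨ +-monoˡ-≤ _ (≤-trans (*-monoˡ-≤ 2 ds≤) c-good) ⟩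
    χ G + 2 * (k * h (3 + t) G)              ∎)
    where
    open ≤-Reasoning
    open +-*-Solver
    coloured = colouringWithFewMonochromaticCycles G t k (χ G) few
    c = proj₁ coloured
    c-good = proj₂ coloured
    vertex : ∀ {K} → K ∈ᴸ shortCycles t G → ∃ λ v → v ∈ Graph.V K
    vertex {K} K∈ =
      let i , _ , K∈i = findᴸ (∈ₚ.∈-concatMap⁻ (λ i → cycles (3 + toℕ i) G) {xs = allFin t} K∈)
      in cycle-vertex {K = K} (proj₂ (∈-cycles⁻ {G = G} K∈i))
    hitting = hittingList (shortCycles t G) (λ K → monochromatic (Graph.V K) c) vertex
    ds = proj₁ hitting
    ds≤ = proj₁ (proj₂ hitting)
    short : ∀ {ℓ K} → K ⊑ G → IsCycle ℓ K → ℓ < 3 + t → K ∈ᴸ shortCycles t G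
    short {K = K} K⊑G cyc@(s≤s (s≤s (s≤s {n = l} _)) , _) (s≤s (s≤s (s≤s l<t))) =
      ∈ₚ.∈-concatMap⁺ (λ i → cycles (3 + toℕ i) G) (lose (∈ₚ.∈-allFin (fromℕ< l<t))
        (∈-cycles⁺ {G = G} K⊑G (subst (λ ℓ → IsCycle (3 + ℓ) K) (sym (Finₚ.toℕ-fromℕ< l<t)) cyc)))
    -- A short cycle inside part j has only the colour j, so it is monochromatic and contains a
    -- deleted vertex, which no part has.
    girth : ∀ j → Girth≥ (3 + t) (part G ds c j)
    girth j ℓ K K⊑P@(V⊆ , _) cyc = ≮⇒≥ λ ℓ<r →
      let v , v∈ds , v∈K = proj₂ (proj₂ hitting) (short {K = K} (⊑-trans K (part G ds c j) G K⊑P (part-⊑ G ds c j)) cyc ℓ<r)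
                             (0<monochromatic j (Graph.V K) c λ u∈ → proj₁ (∈-part⁻ G ds c (V⊆ u∈)))
      in proj₂ (∈-part⁻ G ds c (V⊆ v∈K)) v∈ds

-- Integer roots and inequalities between powers.

module Roots where

  open import Data.Nat
  open import Data.Nat.Properties
  open import Data.Nat.Solver using (module +-*-Solver)
  open +-*-Solver
  open ≤-Reasoning

  ^-cancelˡ-≤ : ∀ n .{{_ : NonZero n}} {a b} → a ^ n ≤ b ^ n → a ≤ b
  ^-cancelˡ-≤ n le = ≮⇒≥ λ b<a → <⇒≱ (^-monoˡ-< n b<a) le

  *-^ : ∀ a b n → (a * b) ^ n ≡ a ^ n * b ^ n
  *-^ a b zero    = refl
  *-^ a b (suc n) = trans (cong (a * b *_) (*-^ a b n))
    (solve 4 (λ a b x y → a :* b :* (x :* y) := a :* x :* (b :* y)) refl a b (a ^ n) (b ^ n))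

  -- `suc k` is the n-th root of `suc T` rounded up. When the radicand grows by 1 it grows by at
  -- most 1, hence the induction on T.
  ceilRoot : ∀ n .{{_ : NonZero n}} T → ∃ λ k → k ^ n < suc T × suc T ≤ suc k ^ n
  ceilRoot n@(suc _) zero    = 0 , s≤s z≤n , ≤-reflexive (sym (^-zeroˡ n))
  ceilRoot n         (suc T) with ceilRoot n T
  ... | k , lo , hi with suc (suc T) ≤? suc k ^ n
  ...   | yes ≤k = k , m≤n⇒m≤1+n lo , ≤k
  ...   | no  ≰k = suc k , s≤s (s≤s⁻¹ (≰⇒> ≰k)) , ≤-trans (s≤s hi) (^-monoˡ-< n (n<1+n (suc k)))

  -- Rounding a root that is at least 1 up to an integer at most doubles it. The form `suc k` makes
  -- it a positive number of colours.
  approximateRoot : ∀ n .{{_ : NonZero n}} T .{{_ : NonZero T}} → ∃ λ k → T ≤ suc k ^ n × suc k ^ n ≤ 2 ^ n * T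
  approximateRoot n (suc T) with ceilRoot n T
  ... | zero  , _  , hi = 0 , hi , ≤-trans (≤-reflexive (^-zeroˡ n)) (*-mono-≤ {1} {2 ^ n} {1} {suc T} (m^n>0 2 n) (s≤s z≤n))
  ... | suc k , lo , hi = suc k , hi , (begin
    (2 + k) ^ n        ≤⟨ ^-monoˡ-≤ n (≤-trans (m≤m+n (2 + k) k) (≤-reflexive (solve 1 (λ k → con 2 :+ k :+ k := con 2 :* (con 1 :+ k)) refl k))) ⟩
    (2 * suc k) ^ n    ≡⟨ *-^ 2 (suc k) n ⟩
    2 ^ n * suc k ^ n  ≤⟨ *-monoʳ-≤ (2 ^ n) (<⇒≤ lo) ⟩
    2 ^ n * suc T      ∎)

  -- count says c ≤ N m^(1 + l P/D), and large says k ≥ K m^(P/D), both raised to the power D.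
  scaledBound : ∀ {m K k D P c N s} l .{{_ : NonZero l}} .{{_ : NonZero D}} .{{_ : NonZero K}} →
    c ^ D ≤ N ^ D * m ^ (D + P * l) → s * N ≤ K → K ^ D * m ^ P ≤ k ^ D → s * c ≤ m * k ^ l
  scaledBound {m} {K} {k} {D} {P} {c} {N} {s} l@(suc l-1) count sN≤K large = ^-cancelˡ-≤ D (begin
    (s * c) ^ D                          ≡⟨ *-^ s c D ⟩
    s ^ D * c ^ D                        ≤⟨ *-monoʳ-≤ (s ^ D) count ⟩
    s ^ D * (N ^ D * m ^ (D + P * l))    ≡⟨ trans (sym (*-assoc (s ^ D) (N ^ D) _)) (cong₂ _*_ (sym (*-^ s N D)) (^-distribˡ-+-* m D (P * l))) ⟩
    -- One factor K absorbs s N; the other factors are at least 1.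
    (s * N) ^ D * (m ^ D * m ^ (P * l))  ≤⟨ *-mono-≤ (≤-trans (^-monoˡ-≤ D sN≤K) (m≤m^n (K ^ D))) (≤-reflexive (cong (m ^ D *_) (sym (^-*-assoc m P l)))) ⟩
    (K ^ D) ^ l * (m ^ D * (m ^ P) ^ l)  ≡⟨ trans (solve 3 (λ x y z → x :* (y :* z) := y :* (x :* z)) refl ((K ^ D) ^ l) (m ^ D) ((m ^ P) ^ l)) (cong (m ^ D *_) (sym (*-^ (K ^ D) (m ^ P) l))) ⟩
    m ^ D * (K ^ D * m ^ P) ^ l          ≤⟨ *-monoʳ-≤ (m ^ D) (^-monoˡ-≤ l large) ⟩
    m ^ D * (k ^ D) ^ l                  ≡⟨ trans (cong (m ^ D *_) (trans (^-*-assoc k D l) (trans (cong (k ^_) (*-comm D l)) (sym (^-*-assoc k l D))))) (sym (*-^ m (k ^ l) D)) ⟩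
    (m * k ^ l) ^ D                      ∎)
    where
    m≤m^n : ∀ x .{{_ : NonZero x}} → x ≤ x ^ l
    m≤m^n x = ≤-trans (≤-reflexive (sym (*-identityʳ x))) (*-monoʳ-≤ x (m^n>0 x l-1))
    instance _ = m^n≢0 K D

  -- Put e = (I - J)/D, so that P/D = 1 - e. From k ≤ 2 K m^(1-e) and m ≤ 2 k h follows m^e ≤ 4 K h;
  -- this is its D-th power with the negative part of the exponent moved to the right.
  invert : ∀ {m K k D P I J h} .{{_ : NonZero m}} → P + I ≡ D + J →
    k ^ D ≤ 2 ^ D * (K ^ D * m ^ P) → m ≤ 2 * (k * h) → m ^ I ≤ m ^ J * (4 * K * h) ^ D
  invert {m} {K} {k} {D} {P} {I} {J} {h} P+I≡D+J small m≤2kh = *-cancelˡ-≤ (m ^ P) {{m^n≢0 m P}} (begin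
    m ^ P * m ^ I                                ≡⟨ trans (sym (^-distribˡ-+-* m P I)) (trans (cong (m ^_) P+I≡D+J) (^-distribˡ-+-* m D J)) ⟩
    m ^ D * m ^ J                                ≤⟨ *-monoˡ-≤ (m ^ J) (^-monoˡ-≤ D m≤2kh) ⟩
    (2 * (k * h)) ^ D * m ^ J                    ≡⟨ cong (_* m ^ J) (trans (*-^ 2 (k * h) D) (cong (2 ^ D *_) (*-^ k h D))) ⟩
    2 ^ D * (k ^ D * h ^ D) * m ^ J              ≤⟨ *-monoˡ-≤ (m ^ J) (*-monoʳ-≤ (2 ^ D) (*-monoˡ-≤ (h ^ D) small)) ⟩
    2 ^ D * (2 ^ D * (K ^ D * m ^ P) * h ^ D) * m ^ J
      ≡⟨ solve 5 (λ t K p h j → t :* (t :* (K :* p) :* h) :* j := p :* (j :* (t :* t :* K :* h))) refl (2 ^ D) (K ^ D) (m ^ P) (h ^ D) (m ^ J) ⟩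
    m ^ P * (m ^ J * (2 ^ D * 2 ^ D * K ^ D * h ^ D))
      ≡⟨ cong (λ z → m ^ P * (m ^ J * z)) (sym (trans (*-^ (4 * K) h D) (cong (_* h ^ D) (trans (*-^ 4 K D) (cong (_* K ^ D) (*-^ 2 2 D)))))) ⟩
    m ^ P * (m ^ J * (4 * K * h) ^ D)            ∎)

-- Rational inequalities read off Dedekind cuts.

module Cuts where

  open Defs.Reals hiding (ℝ; fromℕ; _≤ʳ_; _<ʳ_; _-ʳ_; _*ʳ_; _÷ʳ_; _⊓ʳ_; _^ʳ_)
  open ℝ
  open import Algebra.Bundles using (CommutativeRing)
  open import Data.Fin using (Fin; zero; suc)
  open import Data.Nat as ℕ using (ℕ; zero; suc)
  import Data.Nat.Properties as ℕₚ
  open import Data.Integer using (+<+)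
  open import Data.Rational
  open import Data.Rational.Properties
  open import Data.Rational.Solver using (module +-*-Solver)
  open import Data.Vec.Functional using (foldr)
  open import Algebra.Properties.CommutativeSemiring.Exp
    (CommutativeRing.commutativeSemiring +-*-commutativeRing) using (_^_; ^-assocʳ; ^-distrib-*)
  open +-*-Solver using (solve; _:+_; _:*_; _:-_; :-_; _:=_)

  ι-^ : ∀ m n → ι (m ℕ.^ n) ≡ ι m ^ n
  ι-^ m zero    = refl
  ι-^ m (suc n) = trans (ι-* m (m ℕ.^ n)) (cong (ι m *_) (ι-^ m n))

  L-foldr-⊓ : ∀ {n} (f : Fin n → ℝ) z {q} → L (foldr _⊓ʳ_ z f) q → L z q × (∀ i → L (f i) q)
  L-foldr-⊓ {zero}  f z Lq = Lq , λ ()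
  L-foldr-⊓ {suc n} f z (L₀ , Lq) = let Lz , L₊ = L-foldr-⊓ (λ i → f (suc i)) z Lq in
    Lz , λ { zero → L₀ ; (suc i) → L₊ i }

  -- Let b be the lower end of the interval of y in the box that witnesses q < c y. The point (c, b)
  -- lies in that box, whatever the sign of c.
  L-fromℚ-* : ∀ {c y q} → L (fromℚ c *ʳ y) q → ∃ λ b → L y b × q < c * b
  L-fromℚ-* {c} {y} {q} (a , a′ , b , b′ , (a<c , c<a′) , (Lb , Ub) , corners) =
    b , Lb , box< {a} {c} {a′} {b} {b} {b′} (<⇒≤ a<c) (<⇒≤ c<a′) ≤-refl (<⇒≤ (L<U y Lb Ub)) corners

  -- Trades the real factor x for an upper bound N. If a′ ≤ N, then q < a′ b and a′ can grow to N
  -- once b is replaced by s ≥ 0; otherwise N lies in [a, a′] and q < N b.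
  L-* : ∀ {x y q N} → L x 0ℚ → U x N → L (x *ʳ y) q → ∃ λ b → L y b × (∀ {s} → 0ℚ ≤ s → b ≤ s → q ≤ N * s)
  L-* {x} {y} {q} {N} Lx0 UN (a , a′ , b , b′ , (La , Ua) , (Lb , Ub) , ab , _ , a′b , _) = b , Lb , bound
    where
    bound : ∀ {s} → 0ℚ ≤ s → b ≤ s → q ≤ N * s
    bound {s} 0≤s b≤s with a′ ≤? N
    ... | yes a′≤N = ≤-trans (<⇒≤ a′b) (≤-trans (*-monoˡ-≤-nonNeg a′ {{nonNegative (<⇒≤ (L<U x Lx0 Ua))}} b≤s)
                       (*-monoʳ-≤-nonNeg s {{nonNegative 0≤s}} a′≤N))
    ... | no  a′≰N = ≤-trans (<⇒≤ (segment< (<⇒≤ (L<U x La UN)) (<⇒≤ (≰⇒> a′≰N)) ab a′b))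
                       (*-monoˡ-≤-nonNeg N {{nonNegative (<⇒≤ (L<U x Lx0 UN))}} b≤s)

  L-minus : ∀ {x y a c} → L (fromℚ x -ʳ y) c → L y a → c ≤ x - a
  L-minus {x} {y} {a} {c} (a₁ , b , a₁<x , U-b , c<a₁+b) La = ≤-trans (<⇒≤ c<a₁+b)
    (+-mono-≤ (<⇒≤ a₁<x) (subst (_≤ - a) (solve 1 (λ b → :- (:- b) := b) refl b) (neg-antimono-≤ (<⇒≤ (L<U y La U-b)))))

  -- With e = (I − J) / D < 1, P / D is the exponent 1 − e.
  complement : ∀ e → e < 1ℚ → ∃ λ P → P ℕ.+ num⁺ e ≡ ↧ₙ e ℕ.+ num⁻ e
  complement e e<1 = ↧ₙ e ℕ.+ num⁻ e ℕ.∸ num⁺ e , ℕₚ.m∸n+n≡m (ι-cancel (subst₂ _≤_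
      (trans (cong (_+ ι (num⁻ e)) (exponent e)) (solve 2 (λ i j → i :- j :+ j := i) refl (ι (num⁺ e)) (ι (num⁻ e))))
      (trans (cong (_+ ι (num⁻ e)) (*-identityˡ (ι (↧ₙ e)))) (sym (ι-+ (↧ₙ e) (num⁻ e))))
      (+-monoˡ-≤ (ι (num⁻ e)) (*-monoʳ-≤-nonNeg (ι (↧ₙ e)) {{nonNegative (0≤ι (↧ₙ e))}} (<⇒≤ e<1)))))

  -- Rational powers of a positive integer m.

  module _ (m-1 : ℕ) where

    private
      m = suc m-1
      1≤m : 1ℚ ≤ ι m
      1≤m = ι-mono {1} {m} (ℕ.s≤s ℕ.z≤n)

    -- Since P/D = 1 - e, the integer D + P l equals D (l + 1 - e l), which is at least D e′; and
    -- powers of m ≥ 1 grow with the exponent.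
    powerBound : ∀ e {P} l {e′ s} → P ℕ.+ num⁺ e ≡ ↧ₙ e ℕ.+ num⁻ e → e′ ≤ ι (suc l) - e * ι l → 0ℚ ≤ s →
                 s ≤[ ι m ^ e′ ] → s ^ ↧ₙ e ≤ ι (m ℕ.^ (↧ₙ e ℕ.+ P ℕ.* l))
    powerBound e {P} l {e′} {s} eqP e′≤ 0≤s s≤ =
      -- The upper exponent is the integer Q, passed as the fraction (Q - 0)/1.
      lowerBelowUpper {ι m} 1≤m (I′ ℕ.* D) (J′ ℕ.* D) (ℚ.denominator-1 e′) Q 0 0 (0≤^ D 0≤s) (0≤ι (m ℕ.^ Q))
        (subst₂ _≤_ (trans (raise (ι m) s J′ D′ D) (cong (λ z → ι m ^ (J′ ℕ.* D) * z)
                       (trans (cong (s ^_) (ℕₚ.*-comm D′ D)) (sym (^-assocʳ s D D′)))))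
                    (^-assocʳ (ι m) I′ D)
          (^-mono D (0≤* (0≤^ J′ (0≤ι m)) (0≤^ D′ 0≤s)) s≤))
        (≤-reflexive (trans (sym (ι-^ m Q)) (sym (trans (*-identityˡ _) (*-identityʳ _)))))
        (ι-cancel le)
      where
      D = ↧ₙ e; I = num⁺ e; J = num⁻ e
      D′ = ↧ₙ e′; I′ = num⁺ e′; J′ = num⁻ e′
      Q = D ℕ.+ P ℕ.* l
      open ≤-Reasoning
      ιP : ι P ≡ ι D - e * ι D
      ιP = trans (solve 2 (λ p i → p := p :+ i :- i) refl (ι P) (ι I))
        (trans (cong (_- ι I) (trans (sym (ι-+ P I)) (trans (cong ι eqP) (ι-+ D J))))
        (trans (solve 3 (λ d j i → d :+ j :- i := d :- (i :- j)) refl (ι D) (ι J) (ι I))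
          (cong (λ z → ι D - z) (sym (exponent e)))))
      ιQ : ι Q ≡ (ι (suc l) - e * ι l) * ι D
      ιQ = trans (ι-+ D (P ℕ.* l)) (trans (cong (ι D +_) (trans (ι-* P l) (cong (_* ι l) ιP)))
        (trans (cong (_+ (ι D - e * ι D) * ι l) (sym (*-identityˡ (ι D))))
        (trans (solve 4 (λ o d e l → o :* d :+ (d :- e :* d) :* l := (o :+ l :- e :* l) :* d) refl 1ℚ (ι D) e (ι l))
          (cong (λ z → (z - e * ι l) * ι D) (sym (ι-+ 1 l))))))
      le : ι (I′ ℕ.* D ℕ.* 1 ℕ.+ 0) ≤ ι (Q ℕ.* D′ ℕ.+ J′ ℕ.* D ℕ.* 1)
      le = begin
        ι (I′ ℕ.* D ℕ.* 1 ℕ.+ 0)                              ≡⟨ trans (cong ι (trans (ℕₚ.+-identityʳ _) (ℕₚ.*-identityʳ _))) (ι-* I′ D) ⟩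
        ι I′ * ι D                                            ≡⟨ solve 3 (λ i j d → i :* d := (i :- j) :* d :+ j :* d) refl (ι I′) (ι J′) (ι D) ⟩
        (ι I′ - ι J′) * ι D + ι J′ * ι D                      ≡⟨ cong (λ z → z * ι D + ι J′ * ι D) (sym (exponent e′)) ⟩
        e′ * ι D′ * ι D + ι J′ * ι D                          ≤⟨ +-monoˡ-≤ (ι J′ * ι D) (*-monoʳ-≤-nonNeg (ι D) {{nonNegative (0≤ι D)}} (*-monoʳ-≤-nonNeg (ι D′) {{nonNegative (0≤ι D′)}} e′≤)) ⟩
        (ι (suc l) - e * ι l) * ι D′ * ι D + ι J′ * ι D       ≡⟨ cong (_+ ι J′ * ι D) (solve 3 (λ x a b → x :* a :* b := x :* b :* a) refl (ι (suc l) - e * ι l) (ι D′) (ι D)) ⟩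
        (ι (suc l) - e * ι l) * ι D * ι D′ + ι J′ * ι D       ≡⟨ cong₂ _+_ (trans (cong (_* ι D′) (sym ιQ)) (sym (ι-* Q D′))) (trans (sym (ι-* J′ D)) (cong ι (sym (ℕₚ.*-identityʳ (J′ ℕ.* D))))) ⟩
        ι (Q ℕ.* D′) + ι (J′ ℕ.* D ℕ.* 1)                     ≡⟨ sym (ι-+ (Q ℕ.* D′) _) ⟩
        ι (Q ℕ.* D′ ℕ.+ J′ ℕ.* D ℕ.* 1)                       ∎

    -- The hypothesis on c only concerns rationals strictly below c; applying it to c/2 costs the factor 2.
    countBound : ∀ {a ε : ℝ} {N} e {P} l c → fromℕ 1 ≤ʳ a → U a (ι N) → L ε (e * ι l) →
                 P ℕ.+ num⁺ e ≡ ↧ₙ e ℕ.+ num⁻ e → fromℕ c ≤ʳ a *ʳ m ^ʳ (fromℕ (suc l) -ʳ ε) →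
                 c ℕ.^ ↧ₙ e ℕ.≤ (2 ℕ.* N) ℕ.^ ↧ₙ e ℕ.* m ℕ.^ (↧ₙ e ℕ.+ P ℕ.* l)
    -- At c = 0 the rational c/2 is not strictly below c, but 0 ^ D = 0 because D ≥ 1.
    countBound e l zero _ _ _ _ _ = ℕ.z≤n
    countBound {a} {ε} {N} e {P} l c@(suc _) 1≤a UN Lε eqP c≤ =
      let b , (e′ , s , Le′ , 0≤s , b<s , s≤) , bound =
            L-* {a} {m ^ʳ (fromℕ (suc l) -ʳ ε)} {ι c * ½} {ι N} (1≤a 0ℚ (positive⁻¹ 1ℚ)) UN (c≤ (ι c * ½) c/2<c)
      in ι-cancel (subst₂ _≤_ (sym (ι-^ c D)) (trans (cong (_* ι (m ℕ.^ Q)) (sym (ι-^ (2 ℕ.* N) D))) (sym (ι-* ((2 ℕ.* N) ℕ.^ D) (m ℕ.^ Q))))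
        (begin
          ι c ^ D                               ≤⟨ ^-mono D (0≤ι c) (double {s} (bound {s} 0≤s (<⇒≤ b<s))) ⟩
          (ι (2 ℕ.* N) * s) ^ D                 ≡⟨ ^-distrib-* (ι (2 ℕ.* N)) s D ⟩
          ι (2 ℕ.* N) ^ D * s ^ D               ≤⟨ *-monoˡ-≤-nonNeg (ι (2 ℕ.* N) ^ D) {{nonNegative (0≤^ D (0≤ι (2 ℕ.* N)))}}
                                                     (powerBound e {P} l {e′} {s} eqP (L-minus {ι (suc l)} {ε} {e * ι l} Le′ Lε) 0≤s s≤) ⟩
          ι (2 ℕ.* N) ^ D * ι (m ℕ.^ Q)         ∎))
      where
      open ≤-Reasoning
      D = ↧ₙ e
      Q = D ℕ.+ P ℕ.* l
      c/2<c : ι c * ½ < ι c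
      c/2<c = subst (ι c * ½ <_) (*-identityʳ (ι c))
        (*-monoʳ-<-pos (ι c) {{positive (<-≤-trans (positive⁻¹ 1ℚ) (ι-mono {1} {c} (ℕ.s≤s ℕ.z≤n)))}} ½<1)
        where
        ½<1 : ½ < 1ℚ
        ½<1 = *<* (+<+ ℕₚ.≤-refl)
      double : ∀ {s} → ι c * ½ ≤ ι N * s → ι c ≤ ι (2 ℕ.* N) * s
      double {s} le = subst₂ _≤_
        (trans (sym (*-distribˡ-+ (ι c) ½ ½)) (*-identityʳ (ι c)))
        (trans (sym (*-distribʳ-+ s (ι N) (ι N))) (cong (_* s) (trans (sym (ι-+ N N)) (cong (λ z → ι (N ℕ.+ z)) (sym (ℕₚ.+-identityʳ N))))))
        (+-mono-≤ le le)

    -- The second hypothesis is m^e ≤ H with the denominator of e cleared; cancelling the negative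
    -- power and taking D-th roots compares s with H.
    powerUpper : ∀ e {s H} → s ≤[ ι m ^ e ] → m ℕ.^ num⁺ e ℕ.≤ m ℕ.^ num⁻ e ℕ.* H ℕ.^ ↧ₙ e → s ≤ ι H
    powerUpper e {s} {H} s≤ le = ^-cancel-≤ (ℚ.denominator-1 e) (0≤ι H)
      (*-cancelˡ-≤-pos (ι m ^ num⁻ e) {{positive (0<^ (num⁻ e) (<-≤-trans (positive⁻¹ 1ℚ) 1≤m))}}
        (≤-trans s≤ (subst₂ _≤_ (ι-^ m (num⁺ e))
          (trans (ι-* (m ℕ.^ num⁻ e) (H ℕ.^ ↧ₙ e)) (cong₂ _*_ (ι-^ m (num⁻ e)) (ι-^ H (↧ₙ e))))
          (ι-mono le))))

-- From rational exponents below θ to the real bound.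

module Exponents where

  open Defs.Reals hiding (ℝ; fromℕ; _≤ʳ_; _<ʳ_; _-ʳ_; _*ʳ_; _÷ʳ_; _⊓ʳ_; _^ʳ_)
  open ℝ
  open Deletion using (∑; ∈⇒≤∑)
  open Roots
  open Cuts
  open import Data.Fin using (Fin; toℕ)
  open import Data.List using (allFin)
  open import Data.List.Membership.Propositional.Properties using (∈-allFin)
  open import Data.Nat as ℕ using (ℕ; zero; suc; _^_)
  import Data.Nat.Properties as ℕₚ
  open import Data.Rational
  open import Data.Rational.Properties
  open import Data.Vec.Functional using (foldr)

  -- The index i stands for the cycle length ℓ = 3 + i, so that ℓ - 1 is 2 + i.
  Counted : ∀ {t} → (A ε : Fin t → ℝ) → (Fin t → ℕ) → ℕ → Set
  Counted A ε count m = ∀ i → fromℕ (count i) ≤ʳ A i *ʳ m ^ʳ (fromℕ (3 ℕ.+ toℕ i) -ʳ ε i)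

  -- What deletion gives when m = χ G, count i = C (3 + i) G and H = h (3 + t) G.
  DeletionBound : ∀ {t} → (Fin t → ℕ) → ℕ → ℕ → Set
  DeletionBound {t} count H m = ∀ k .{{_ : ℕ.NonZero k}} →
    (∀ i → 2 ℕ.* t ℕ.* count i ℕ.≤ m ℕ.* k ^ (2 ℕ.+ toℕ i)) → m ℕ.≤ 2 ℕ.* (k ℕ.* H)

  module _ {t} (A ε : Fin t → ℝ) (N : Fin t → ℕ) (K-1 : ℕ)
    (1≤A : ∀ i → fromℕ 1 ≤ʳ A i) (A<N : ∀ i → U (A i) (ι (N i)))
    (N≤K : ∀ i → 2 ℕ.* t ℕ.* (2 ℕ.* N i) ℕ.≤ suc K-1) (count : Fin t → ℕ) (H : ℕ) where

    private
      K = suc K-1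

    module _ (m-1 : ℕ) (counted : Counted A ε count (suc m-1)) (split : DeletionBound count H (suc m-1)) where

      private
        m = suc m-1

      -- The number suc k of colours approximates K m^(1 − e).
      colourCountSuffices : ∀ e P k → (∀ i → L (ε i) (e * ι (2 ℕ.+ toℕ i))) → P ℕ.+ num⁺ e ≡ ↧ₙ e ℕ.+ num⁻ e →
        K ^ ↧ₙ e ℕ.* m ^ P ℕ.≤ suc k ^ ↧ₙ e → suc k ^ ↧ₙ e ℕ.≤ 2 ^ ↧ₙ e ℕ.* (K ^ ↧ₙ e ℕ.* m ^ P) →
        m ^ num⁺ e ℕ.≤ m ^ num⁻ e ℕ.* (4 ℕ.* K ℕ.* H) ^ ↧ₙ e
      colourCountSuffices e P k e<ε P+I≡D+J large small =
        invert {m} {K} {suc k} {↧ₙ e} {P} {num⁺ e} {num⁻ e} {H} P+I≡D+J small (split (suc k) λ i →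
          scaledBound {m} {K} {suc k} {↧ₙ e} {P} {count i} {2 ℕ.* N i} {2 ℕ.* t} (2 ℕ.+ toℕ i)
            (countBound m-1 {A i} {ε i} {N i} e {P} (2 ℕ.+ toℕ i) (count i) (1≤A i) (A<N i) (e<ε i) P+I≡D+J (counted i))
            (N≤K i) large)

      -- A rational e below θ satisfies e < 1 and e (ℓ - 1) < ε_ℓ for each ℓ; the latter holds by
      -- computation, because `_÷ʳ_` rescales the cut.
      rationalBound : ∀ e → L (foldr _⊓ʳ_ (fromℕ 1) (λ i → ε i ÷ʳ (2 ℕ.+ toℕ i))) e →
        m ^ num⁺ e ℕ.≤ m ^ num⁻ e ℕ.* (4 ℕ.* K ℕ.* H) ^ ↧ₙ e
      rationalBound e Lθ =
        let e<1 , e<ε         = L-foldr-⊓ (λ i → ε i ÷ʳ (2 ℕ.+ toℕ i)) (fromℕ 1) Lθ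
            P , P+I≡D+J       = complement e e<1
            k , large , small = approximateRoot (↧ₙ e) (K ^ ↧ₙ e ℕ.* m ^ P)
                                  {{ℕₚ.m*n≢0 (K ^ ↧ₙ e) (m ^ P) {{ℕₚ.m^n≢0 K (↧ₙ e)}} {{ℕₚ.m^n≢0 m P}}}}
        in colourCountSuffices e P k e<ε P+I≡D+J large small

    lowerBound : ∀ {c₀} m → 0ℚ < c₀ → ι (4 ℕ.* K) * c₀ ≡ 1ℚ → Counted A ε count m → DeletionBound count H m →
      fromℚ c₀ *ʳ m ^ʳ foldr _⊓ʳ_ (fromℕ 1) (λ i → ε i ÷ʳ (2 ℕ.+ toℕ i)) ≤ʳ fromℕ H
    -- For m = 0 the power is 0 by convention, so q lies below c₀ · 0 and is negative.
    lowerBound {c₀} zero 0<c₀ _ _ _ q Lq =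
      let b , b<0 , q<c₀b = L-fromℚ-* {c₀} {fromℚ 0ℚ} Lq
      in <-≤-trans (<-trans q<c₀b (subst (c₀ * b <_) (*-zeroʳ c₀) (*-monoʳ-<-pos c₀ {{positive 0<c₀}} b<0))) (0≤ι H)
    lowerBound {c₀} m@(suc m-1) 0<c₀ 4Kc₀≡1 counted split q Lq =
      -- The cut of m^θ supplies a rational e < θ and some s with b < s ≤ m^e. Then s ≤ 4 K H, and
      -- c₀ = 1/(4 K) cancels the 4 K.
      let b , (e , s , Lθ , 0≤s , b<s , s≤) , q<c₀b =
            L-fromℚ-* {c₀} {m ^ʳ foldr _⊓ʳ_ (fromℕ 1) (λ i → ε i ÷ʳ (2 ℕ.+ toℕ i))} Lq
          s≤4KH = powerUpper m-1 e {s} {4 ℕ.* K ℕ.* H} s≤ (rationalBound m-1 counted split e Lθ)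
      in <-≤-trans q<c₀b (≤-trans (*-monoˡ-≤-nonNeg c₀ {{nonNegative (<⇒≤ 0<c₀)}} (≤-trans (<⇒≤ b<s) s≤4KH)) (≤-reflexive cancel))
      where
      cancel : c₀ * ι (4 ℕ.* K ℕ.* H) ≡ ι H
      cancel = trans (cong (c₀ *_) (ι-* (4 ℕ.* K) H)) (trans (sym (*-assoc c₀ (ι (4 ℕ.* K)) (ι H)))
        (trans (cong (_* ι H) (trans (*-comm c₀ (ι (4 ℕ.* K))) 4Kc₀≡1)) (*-identityˡ (ι H))))

  -- The choice of the constant.

  naturalAbove : ∀ x → ∃ λ N → U x (ι N)
  naturalAbove x = let (u , Uu) = proj₂ (inhabited x); N , u<N = archimedean u in N , U-up x u<N Uu

  -- The sum of all `N i` dominates each of them, and the successor keeps K positive.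
  upperBounds : ∀ {t} (A : Fin t → ℝ) s → ∃ λ (N : Fin t → ℕ) → ∃ λ K-1 →
    (∀ i → U (A i) (ι (N i))) × (∀ i → s ℕ.* N i ℕ.≤ suc K-1)
  upperBounds {t} A s = N , s ℕ.* ∑ (allFin t) N , (λ i → proj₂ (naturalAbove (A i))) ,
    λ i → ℕₚ.m≤n⇒m≤1+n (ℕₚ.*-monoʳ-≤ s (∈⇒≤∑ N (∈-allFin i)))
    where
    N = λ i → proj₁ (naturalAbove (A i))

  -- Graphs enter only through the counts, H and m. These and ε are quantified after c, so c can
  -- depend on t and A alone.
  LowerBound : ∀ {t} → (Fin t → ℝ) → ℝ → Set₁
  LowerBound A c = ∀ ε count H m → Counted A ε count m → DeletionBound count H m →
    c *ʳ m ^ʳ foldr _⊓ʳ_ (fromℕ 1) (λ i → ε i ÷ʳ (2 ℕ.+ toℕ i)) ≤ʳ fromℕ H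

  constant : ∀ {t} (A : Fin t → ℝ) → (∀ i → fromℕ 1 ≤ʳ A i) → ∃ λ c → fromℕ 0 <ʳ c × LowerBound A c
  -- The factor 2 t comes from averaging over t lengths, the other 2 from the halving in
  -- `countBound`.
  constant {t} A 1≤A = choose (upperBounds A (2 ℕ.* t ℕ.* 2))
    where
    choose : (∃ λ (N : Fin t → ℕ) → ∃ λ K-1 →
               (∀ i → U (A i) (ι (N i))) × (∀ i → 2 ℕ.* t ℕ.* 2 ℕ.* N i ℕ.≤ suc K-1)) →
             ∃ λ c → fromℕ 0 <ʳ c × LowerBound A c
    -- The successor of this argument computes to 4 K, so c₀ is 1/(4 K).
    choose (N , K-1 , A<N , N≤K) = scale (1/suc (K-1 ℕ.+ 3 ℕ.* suc K-1))
      where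
      scale : (∃ λ c₀ → 0ℚ < c₀ × ι (4 ℕ.* suc K-1) * c₀ ≡ 1ℚ) → ∃ λ c → fromℕ 0 <ʳ c × LowerBound A c
      scale (c₀ , 0<c₀ , 4Kc₀≡1) = fromℚ c₀ , <-dense 0<c₀ , λ ε count H m → lowerBound A ε N K-1 1≤A A<N
        (λ i → subst (ℕ._≤ suc K-1) (ℕₚ.*-assoc (2 ℕ.* t) 2 (N i)) (N≤K i)) count H {c₀} m 0<c₀ 4Kc₀≡1

-- The lower bound for `h r G`.

open import Data.Fin using (Fin; toℕ)
open import Data.Nat using (ℕ; _+_; _*_; _∸_; _≤_; >-nonZero)
open import Data.Nat.Properties using (≤-trans; n≤1+n; m<n⇒0<n∸m; m+[n∸m]≡n)
open import Data.Vec.Functional using (foldr)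

corollary1p4 :
  (r : ℕ) → 4 ≤ r →
  (A : Fin (r ∸ 3) → ℝ) → (∀ i → fromℕ 1 ≤ʳ A i) →
  ∃ λ (c : ℝ) → fromℕ 0 <ʳ c ×
    (∀ (n : ℕ) (G : Graph n) (m : ℕ) (ε : Fin (r ∸ 3) → ℝ) →
      χ G ≡ m →
      (∀ i → fromℕ 0 <ʳ ε i) →
      (∀ i → fromℕ (C (3 + toℕ i) G) ≤ʳ A i *ʳ m ^ʳ (fromℕ (3 + toℕ i) -ʳ ε i)) →
      c *ʳ m ^ʳ (foldr _⊓ʳ_ (fromℕ 1) (λ i → ε i ÷ʳ (2 + toℕ i))) ≤ʳ fromℕ (h r G))
corollary1p4 r 4≤r A 1≤A = map₂ (map₂ λ bound n G m ε χ≡m _ counts →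
    bound ε (λ i → C (3 + toℕ i) G) (h r G) m counts (split n G m χ≡m)) (Exponents.constant A 1≤A)
  where
  split : ∀ n (G : Graph n) m → χ G ≡ m → Exponents.DeletionBound {r ∸ 3} (λ i → C (3 + toℕ i) G) (h r G) m
  -- With t = r ∸ 3, the condition r ≥ 4 gives both 3 + t = r and t > 0.
  split n G _ refl k few = subst (λ r → χ G ≤ 2 * (k * h r G)) (m+[n∸m]≡n (≤-trans (n≤1+n 3) 4≤r))
    (Deletion.χ≤2kh G (r ∸ 3) k {{>-nonZero (m<n⇒0<n∸m 4≤r)}} few)
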